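{- Let $b$ be a graph over $(X,m)$ with $m(X)<\infty$. For any $p\in[1,\infty)$ and any function $d:X\times X\to[0,\infty)$ with $\delta(d)>0$, we have $$\lambda^{(1)}_{p}\leq 2^{p-1}\,\frac{h^{(1)}(d)}{\delta(d)}.$$
   Context: Setting: $X$ is a countable (finite or infinite) set with at least two elements, and $C(X)$ is the space of real-valued functions on $X$. A graph $b$ over $(X,m)$ consists of a symmetric function $b:X\times X\to[0,\infty)$ with $b(x,x)=0$ and $\sum_{y\in X}b(x,y)<\infty$ for all $x\in X$, and a function $m:X\to(0,\infty)$, extended to a measure on subsets by $m(W)=\sum_{x\in W}m(x)$. $\ell^p(X,m)$ is the space of $f\in C(X)$ with $\|f\|_{m,p}=\bigl(\sum_{x\in X}|f(x)|^p m(x)\bigr)^{1/p}<\infty$. Energy: $\mathcal{E}_p(f)=\frac12\sum_{x,y\in X}b(x,y)|f(x)-f(y)|^p\in[0,\infty]$ for $f\in C(X)$, and (for $m(X)<\infty$) $$\lambda^{(1)}_p=\inf_{f\in\ell^p(X,m),\ f\text{ non-constant}}\ \frac{\mathcal{E}_p(f)}{\inf_{\gamma\in\mathbb{R}}\|f-\gamma\|_{m,p}^p}.$$ For $W\subseteq X$, $\partial W=W\times(X\setminus W)$, and for $d:X\times X\to[0,\infty)$, $|\partial W|_{bd}=\sum_{(x,y)\in\partial W}b(x,y)d(x,y)\in[0,\infty]$, $$h^{(1)}(d)=\inf_{\emptyset\ne W\subseteq X,\ m(W)\le m(X)/2}\frac{|\partial W|_{bd}}{m(W)},\qquad \delta(d)=\inf\{d(x,y):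 x,y\in X,\ b(x,y)>0\}.$$ Conventions: $\inf\emptyset=+\infty$ and $a/(+\infty)=0$ for $a\in[0,\infty)$ (relevant only if $b\equiv0$). -}

module Defs where

open import Algebra.Bundles using (CommutativeRing; Semiring)
open import Axiom.ExcludedMiddle using (ExcludedMiddle)
open import Data.Bool.Base using (Bool; T)
open import Data.List.Base using (List; map; foldr)
open import Data.List.Relation.Unary.All using (All)
open import Data.List.Relation.Unary.Unique.Propositional using (Unique)
open import Data.Nat.Base using (ℕ; suc)
open import Data.Product.Base using (Σ; ∃; ∃₂; _×_; _,_; proj₁; proj₂; uncurry)
open import Data.Sum.Base using (_⊎_; [_,_]′)
open import Function.Base using (_∘_)
open import Level using (0ℓ) renaming (suc to lsuc)
open import Relation.Binary.Structures using (IsTotalOrder)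
open import Relation.Nullary.Decidable.Core using (yes; no)
open import Relation.Nullary.Negation.Core using (¬_)
open import Relation.Nullary.Construct.Add.Supremum using (_⁺; ⊤⁺; [_])
open import Relation.Unary using (Pred; U; ∁; Satisfiable; _⟨×⟩_)
import Algebra.Definitions.RawSemiring as RawSemiringOps
import Relation.Binary.Construct.NonStrictToStrict as ToStrict
import Relation.Binary.Construct.Add.Supremum.NonStrict as Add≤
import Relation.Binary.Construct.Add.Supremum.Strict as Add<

-- The real numbers, given by their categorical axiomatisation: a totally
-- ordered field with least upper bounds (unique up to isomorphism, in
-- classical logic).
record CompleteOrderedField : Set₁ where
  infix 4 _≤_
  field
    commutativeRing : CommutativeRing 0ℓ 0ℓ
  open CommutativeRing commutativeRing public
  field
    _≤_          : Carrier → Carrier → Set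
    isTotalOrder : IsTotalOrder _≈_ _≤_
    +-monoʳ-≤    : ∀ x {y z} → y ≤ z → x + y ≤ x + z
    *-nonneg     : ∀ {x y} → 0# ≤ x → 0# ≤ y → 0# ≤ x * y
    0≉1          : ¬ 0# ≈ 1#
    invertible   : ∀ x → ¬ x ≈ 0# → ∃ λ y → x * y ≈ 1#

  UpperBound : Pred Carrier 0ℓ → Pred Carrier 0ℓ
  UpperBound S u = ∀ x → S x → x ≤ u

  IsLub : Pred Carrier 0ℓ → Pred Carrier 0ℓ
  IsLub S s = UpperBound S s × (∀ u → UpperBound S u → s ≤ u)

  field
    complete : (S : Pred Carrier 0ℓ) → Satisfiable S →
               Satisfiable (UpperBound S) → Satisfiable (IsLub S)

-- Excluded middle is what makes suprema in (-∞,∞], and hence infinite sums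
-- and infima, total functions.
module Classical (lem : ExcludedMiddle 0ℓ) (R : CompleteOrderedField) where

  open CompleteOrderedField R public renaming (Carrier to ℝ)
  open RawSemiringOps (Semiring.rawSemiring semiring) public
    using (_^_) renaming (_×_ to _⊗_)
  open ToStrict _≈_ _≤_ public using (_<_)

  ℝ∞ : Set
  ℝ∞ = ℝ ⁺

  open Add≤ _≤_ public using () renaming (_≤⁺_ to _≤∞_)
  open Add< _<_ public using () renaming (_<⁺_ to _<∞_)

  infixl 7 _÷_ _·_
  infix  8 _⁻¹

  2# : ℝ
  2# = 1# + 1#

  ∣_∣ : ℝ → ℝ
  ∣ x ∣ = [ (λ _ → x) , (λ _ → - x) ]′ (IsTotalOrder.total isTotalOrder 0# x)

  -- 0# ⁻¹ = 0# by convention.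
  _⁻¹ : ℝ → ℝ
  x ⁻¹ with lem {x ≈ 0#}
  ... | yes _   = 0#
  ... | no  x≉0 = proj₁ (invertible x x≉0)

  -- For nonempty S: the least upper bound in (-∞,∞].
  sup : Pred ℝ 0ℓ → ℝ∞
  sup S with lem {Satisfiable (IsLub S)}
  ... | yes (s , _) = [ s ]
  ... | no  _       = ⊤⁺

  -- Only used where the value is finite.
  real : ℝ∞ → ℝ
  real [ x ] = x
  real ⊤⁺    = 0#

  -- The real power xᵖ for x ≥ 0 and p ≥ 0.  A real y ≥ 0 satisfies
  -- y ≤ x^(k/n) iff yⁿ ≤ xᵏ, and xᵖ is the supremum of x^q over rationals
  -- 0 ≤ q ≤ p when x ≥ 1, and over rationals q ≥ p when x ≤ 1.
  -- (k ⊗ z is the k-fold sum z + … + z.)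
  BelowPower : ℝ → ℝ → Pred ℝ 0ℓ
  BelowPower x p y = 0# ≤ y × ∃₂ λ k n →
    ((1# ≤ x × k ⊗ 1# ≤ suc n ⊗ p) ⊎ (x ≤ 1# × suc n ⊗ p ≤ k ⊗ 1#)) ×
    y ^ suc n ≤ x ^ k

  pow : ℝ → ℝ → ℝ
  pow x p = real (sup (BelowPower x p))

  -- ∞ᵖ = ∞, for p > 0.
  pow∞ : ℝ∞ → ℝ → ℝ∞
  pow∞ [ x ] p = [ pow x p ]
  pow∞ ⊤⁺    p = ⊤⁺

  -- r · ∞ = ∞, for r > 0.
  _·_ : ℝ → ℝ∞ → ℝ∞
  r · [ x ] = [ r * x ]
  r · ⊤⁺    = ⊤⁺

  -- Division of elements of [0,∞] by elements of (0,∞]; a ÷ ∞ = 0 for finite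
  -- a.  The other cases ([ a ] ÷ [ 0# ] and ∞ ÷ ∞) never arise below.
  _÷_ : ℝ∞ → ℝ∞ → ℝ∞
  [ a ] ÷ [ b ] = [ a * b ⁻¹ ]
  [ a ] ÷ ⊤⁺    = [ 0# ]
  ⊤⁺    ÷ _     = ⊤⁺

  -- The sum of g x over x ∈ P, for g ≥ 0: the supremum of the sums over finite
  -- sets of elements of P, which are presented as duplicate-free lists.
  ∑ : {A : Set} → Pred A 0ℓ → (A → ℝ) → ℝ∞
  ∑ {A} P g = sup λ s → Σ (List A) λ xs →
    Unique xs × All P xs × s ≈ foldr _+_ 0# (map g xs)

  -- The infimum in [0,∞] of g i over i ∈ P, for g ≥ 0: the supremum of the
  -- nonnegative real lower bounds.  In particular it is ∞ if P is empty.
  inf : {I : Set} → Pred I 0ℓ → (I → ℝ∞) → ℝ∞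
  inf P g = sup λ r → 0# ≤ r × (∀ i → P i → [ r ] ≤∞ g i)

  record Graph (X : Set) : Set where
    field
      b          : X → X → ℝ
      b-nonneg   : ∀ x y → 0# ≤ b x y
      b-sym      : ∀ x y → b x y ≈ b y x
      b-diag     : ∀ x → b x x ≈ 0#
      b-summable : ∀ x → ∑ U (b x) <∞ ⊤⁺
      m          : X → ℝ
      m-pos      : ∀ x → 0# < m x

    measure : Pred X 0ℓ → ℝ∞
    measure W = ∑ W m

    ‖_‖_ : (X → ℝ) → ℝ → ℝ∞
    ‖ f ‖ p = pow∞ (∑ U λ x → pow ∣ f x ∣ p * m x) (p ⁻¹)

    ℓ^_ : ℝ → Pred (X → ℝ) 0ℓ
    (ℓ^ p) f = ‖ f ‖ p <∞ ⊤⁺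

    NonConstant : Pred (X → ℝ) 0ℓ
    NonConstant f = ¬ (∃ λ c → ∀ x → f x ≈ c)

    energy : ℝ → (X → ℝ) → ℝ∞
    energy p f =
      2# ⁻¹ · ∑ U (uncurry λ x y → b x y * pow ∣ f x - f y ∣ p)

    λ¹ : ℝ → ℝ∞
    λ¹ p = inf (λ f → (ℓ^ p) f × NonConstant f)
      λ f → energy p f ÷ inf U (λ γ → pow∞ (‖ (λ x → f x - γ) ‖ p) p)

    ∂ : Pred X 0ℓ → Pred (X × X) 0ℓ
    ∂ W = W ⟨×⟩ ∁ W

    boundaryMeasure : (X → X → ℝ) → Pred X 0ℓ → ℝ∞
    boundaryMeasure d W = ∑ (∂ W) (uncurry λ x y → b x y * d x y)

    -- Subsets of X are given by their indicator functions X → Bool; by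
    -- excluded middle these are all the subsets.
    h¹ : (X → X → ℝ) → ℝ∞
    h¹ d = inf {X → Bool}
      (λ W → Satisfiable (T ∘ W) × measure (T ∘ W) ≤∞ measure U ÷ [ 2# ])
      λ W → boundaryMeasure d (T ∘ W) ÷ measure (T ∘ W)

    δ : (X → X → ℝ) → ℝ∞
    δ d = inf (uncurry λ x y → 0# < b x y) (uncurry λ x y → [ d x y ])

{-# OPTIONS --safe #-}
module Submission where

-- Test the Rayleigh quotient with f = 1_W for m(W) ≤ m(X)/2.  Its energy is
-- |∂W|_b ≤ |∂W|_{bd} / δ(d).  Since m(X∖W) ≥ m(W),
--   ‖f - γ‖ᵖ = |1-γ|ᵖ m(W) + |γ|ᵖ m(X∖W) ≥ (|1-γ|ᵖ + |γ|ᵖ) m(W) ≥ 2^(1-p) m(W)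
-- by convexity of the p-th power.  For real p the convexity is obtained from
-- rational approximations of the exponents: with c/b ≤ p-1 ≤ (c+1)/b, Bernoulli's
-- inequality for the exponent (b+c+1)/b gives the claim up to a factor 2^(1/b),
-- which tends to 1.

open import Axiom.ExcludedMiddle using (ExcludedMiddle)
open import Data.Bool.Base using (Bool; true; false; T; not; _∧_; if_then_else_)
open import Data.Bool.Properties using (T?)
open import Data.Empty using (⊥-elim)
open import Data.List.Base using (List; []; _∷_; _++_; map; foldr; filter)
import Data.List.Properties as Listₚ
import Data.List.Relation.Unary.All as All
import Data.List.Relation.Unary.All.Properties as All
open import Data.List.Relation.Unary.All using (All; []; _∷_)
open import Data.List.Relation.Unary.AllPairs using ([]; _∷_)
import Data.List.Relation.Unary.Unique.Propositional.Properties as Unique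
open import Data.List.Relation.Unary.Unique.Propositional using (Unique)
open import Data.Nat.Base as ℕ using (ℕ; zero; suc)
import Data.Nat.Properties as ℕₚ
open import Data.Product.Base using (∃; ∃₂; _×_; _,_; proj₁; proj₂; uncurry; swap)
open import Data.Sum.Base using (inj₁; inj₂; [_,_]′)
open import Function.Base using (_∘_)
open import Function.Bundles using (_↣_)
open import Level using (0ℓ)
open import Relation.Binary.Bundles using (Poset)
open import Relation.Binary.PropositionalEquality.Core as ≡ using (_≡_; _≢_)
open import Relation.Binary.Structures using (IsTotalOrder)
open import Relation.Nullary.Construct.Add.Supremum using (⊤⁺; [_])
open import Relation.Nullary.Decidable.Core using (yes; no; does; ¬?; _×-dec_)
open import Relation.Nullary.Negation.Core using (¬_)
open import Relation.Unary using (Pred; U; ∁; Satisfiable; Decidable)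
open import Defs
import Algebra.Properties.CommutativeSemiring.Exp as Exp
import Algebra.Properties.Ring as RingProperties
import Algebra.Properties.Semiring.Mult as Mult
import Algebra.Solver.Ring.NaturalCoefficients.Default as SemiringSolver
import Relation.Binary.Construct.Add.Supremum.NonStrict as Add≤
import Relation.Binary.Construct.Add.Supremum.Strict as Add<
import Relation.Binary.Reasoning.PartialOrder as PosetReasoning
import Relation.Binary.Reasoning.Setoid as ≈-Reasoning

-- `pow`, `∑` and `inf` are all suprema, and no law of exponents for real powers and no additivity
-- of infinite sums is established. A sum is compared with real upper bounds through its finite
-- partial sums, and a power x^p is bounded below through x^k ≤ (x^p)^b for fractions k/b on the
-- correct side of p. This one-sided information shapes the convexity step: exponents are rounded
-- downwards for a base above 1 and upwards for a base below 1, so 2^(p-1) receives c/b while u^p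
-- receives (b+c+1)/b, and the mismatch is the lost factor. The norm contains a p-th root which the
-- Rayleigh quotient undoes. As the distance to the constants stands in a denominator, x ≤
-- (x^(1/p))^p suffices. The two infima are compared through their lower bounds: each r ≥ 0
-- admissible for `λ¹` makes 2^(1-p) r ε admissible for `h¹`, for every ε > 0 that bounds d from
-- below on the edges. Keeping ε separate from `δ` covers a graph without edges, where `δ` is
-- infinite.

module Theory (lem : ExcludedMiddle 0ℓ) (R : CompleteOrderedField) where

  open Classical lem R
  open IsTotalOrder isTotalOrder using (isPartialOrder; total; antisym)
    renaming (refl to ≤-refl; reflexive to ≤-reflexive; trans to ≤-trans)
  open Exp commutativeSemiring using (^-homo-*; ^-assocʳ; ^-distrib-*)
  open Mult semiring using (×-homo-+; ×-congʳ; ×-assoc-*; ×1-homo-*)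
  open RingProperties ring using (-‿distribʳ-*; -‿involutive)
  open SemiringSolver commutativeSemiring using (solve; _:=_; _:+_; _:*_; con)

  -- Arithmetic in an ordered field

  ≤-poset : Poset 0ℓ 0ℓ 0ℓ
  ≤-poset = record { isPartialOrder = isPartialOrder }

  module ≤-Reasoning = PosetReasoning ≤-poset

  ≮⇒≥ : ∀ {x y} → ¬ (y < x) → x ≤ y
  ≮⇒≥ {x} {y} y≮x with total x y
  ... | inj₁ x≤y = x≤y
  ... | inj₂ y≤x with lem {y ≈ x}
  ...   | yes y≈x = ≤-reflexive (sym y≈x)
  ...   | no  y≉x = ⊥-elim (y≮x (y≤x , y≉x))

  <⇒≱ : ∀ {x y} → x < y → ¬ (y ≤ x)
  <⇒≱ (x≤y , x≉y) y≤x = x≉y (antisym x≤y y≤x)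

  ≰⇒> : ∀ {x y} → ¬ (x ≤ y) → y < x
  ≰⇒> {x} {y} x≰y with total x y
  ... | inj₁ x≤y = ⊥-elim (x≰y x≤y)
  ... | inj₂ y≤x = y≤x , λ y≈x → x≰y (≤-reflexive (sym y≈x))

  +-monoˡ-≤ : ∀ z {x y} → x ≤ y → x + z ≤ y + z
  +-monoˡ-≤ z {x} {y} x≤y = begin
    x + z  ≈⟨ +-comm x z ⟩
    z + x  ≤⟨ +-monoʳ-≤ z x≤y ⟩
    z + y  ≈⟨ +-comm z y ⟩
    y + z  ∎
    where open ≤-Reasoning

  +-mono-≤ : ∀ {x x′ y y′} → x ≤ x′ → y ≤ y′ → x + y ≤ x′ + y′
  +-mono-≤ {x′ = x′} {y = y} x≤x′ y≤y′ = ≤-trans (+-monoˡ-≤ y x≤x′) (+-monoʳ-≤ x′ y≤y′)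

  +-cancelʳ-≤ : ∀ z {x y} → x + z ≤ y + z → x ≤ y
  +-cancelʳ-≤ z {x} {y} le = begin
    x              ≈⟨ cancel x ⟨
    x + z + (- z)  ≤⟨ +-monoˡ-≤ (- z) le ⟩
    y + z + (- z)  ≈⟨ cancel y ⟩
    y              ∎
    where
    open ≤-Reasoning
    cancel : ∀ t → t + z + (- z) ≈ t
    cancel t = trans (+-assoc t z (- z)) (trans (+-congˡ (-‿inverseʳ z)) (+-identityʳ t))

  +-nonneg : ∀ {x y} → 0# ≤ x → 0# ≤ y → 0# ≤ x + y
  +-nonneg 0≤x 0≤y = ≤-trans (≤-reflexive (sym (+-identityʳ 0#))) (+-mono-≤ 0≤x 0≤y)

  x≤x+y : ∀ {x y} → 0# ≤ y → x ≤ x + y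
  x≤x+y {x} 0≤y = ≤-trans (≤-reflexive (sym (+-identityʳ x))) (+-monoʳ-≤ x 0≤y)

  x-y+y≈x : ∀ x y → (x - y) + y ≈ x
  x-y+y≈x x y = trans (+-assoc x (- y) y) (trans (+-congˡ (-‿inverseˡ y)) (+-identityʳ x))

  x≤y⇒0≤y-x : ∀ {x y} → x ≤ y → 0# ≤ y - x
  x≤y⇒0≤y-x {x} {y} x≤y = ≤-trans (≤-reflexive (sym (-‿inverseʳ x))) (+-monoˡ-≤ (- x) x≤y)

  -- Writing y as x + h keeps later identities free of subtraction, within
  -- reach of the semiring solver.
  ≤⇒+ : ∀ {x y} → x ≤ y → ∃ λ h → 0# ≤ h × y ≈ x + h
  ≤⇒+ {x} {y} x≤y = y - x , x≤y⇒0≤y-x x≤y , trans (sym (x-y+y≈x y x)) (+-comm _ x)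

  *-monoˡ-≤ : ∀ {z x y} → 0# ≤ z → x ≤ y → z * x ≤ z * y
  *-monoˡ-≤ {z} {x} {y} 0≤z x≤y with ≤⇒+ x≤y
  ... | h , 0≤h , y≈x+h = begin
    z * x          ≤⟨ x≤x+y (*-nonneg 0≤z 0≤h) ⟩
    z * x + z * h  ≈⟨ distribˡ z x h ⟨
    z * (x + h)    ≈⟨ *-congˡ y≈x+h ⟨
    z * y          ∎
    where open ≤-Reasoning

  *-monoʳ-≤ : ∀ {z x y} → 0# ≤ z → x ≤ y → x * z ≤ y * z
  *-monoʳ-≤ {z} {x} {y} 0≤z x≤y = begin
    x * z  ≈⟨ *-comm x z ⟩
    z * x  ≤⟨ *-monoˡ-≤ 0≤z x≤y ⟩
    z * y  ≈⟨ *-comm z y ⟩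
    y * z  ∎
    where open ≤-Reasoning

  *-mono-≤ : ∀ {x x′ y y′} → 0# ≤ x → x ≤ x′ → 0# ≤ y → y ≤ y′ → x * y ≤ x′ * y′
  *-mono-≤ 0≤x x≤x′ 0≤y y≤y′ =
    ≤-trans (*-monoʳ-≤ 0≤y x≤x′) (*-monoˡ-≤ (≤-trans 0≤x x≤x′) y≤y′)

  0≤1 : 0# ≤ 1#
  0≤1 with total 0# 1#
  ... | inj₁ 0≤1 = 0≤1
  ... | inj₂ 1≤0 = ≤-trans (*-nonneg 0≤-1 0≤-1) (≤-reflexive -1*-1≈1)
    where
    0≤-1 : 0# ≤ - 1#
    0≤-1 = ≤-trans (x≤y⇒0≤y-x 1≤0) (≤-reflexive (+-identityˡ (- 1#)))
    -1*-1≈1 : - 1# * - 1# ≈ 1#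
    -1*-1≈1 = trans (sym (-‿distribʳ-* (- 1#) 1#)) (trans (-‿cong (*-identityʳ (- 1#))) (-‿involutive 1#))

  0<1 : 0# < 1#
  0<1 = 0≤1 , 0≉1

  0≤2 : 0# ≤ 2#
  0≤2 = +-nonneg 0≤1 0≤1

  1≤2 : 1# ≤ 2#
  1≤2 = x≤x+y 0≤1

  <-≤-trans : ∀ {x y z} → x < y → y ≤ z → x < z
  <-≤-trans x<y@(x≤y , _) y≤z =
    ≤-trans x≤y y≤z , λ x≈z → <⇒≱ x<y (≤-trans y≤z (≤-reflexive (sym x≈z)))

  0<2 : 0# < 2#
  0<2 = <-≤-trans 0<1 1≤2

  pos⇒≉0 : ∀ {x} → 0# < x → ¬ x ≈ 0#
  pos⇒≉0 (_ , 0≉x) x≈0 = 0≉x (sym x≈0)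

  *-inverseʳ : ∀ {x} → ¬ x ≈ 0# → x * x ⁻¹ ≈ 1#
  *-inverseʳ {x} x≉0 with lem {x ≈ 0#}
  ... | yes x≈0 = ⊥-elim (x≉0 x≈0)
  ... | no  x≉0 = proj₂ (invertible x x≉0)

  ⁻¹-nonneg : ∀ {x} → 0# ≤ x → 0# ≤ x ⁻¹
  ⁻¹-nonneg {x} 0≤x with lem {x ≈ 0#}
  ... | yes _ = ≤-refl
  ... | no x≉0 with invertible x x≉0
  ...   | y , xy≈1 with total 0# y
  ...     | inj₁ 0≤y = 0≤y
  ...     | inj₂ y≤0 = ⊥-elim (<⇒≱ 0<1 (begin
    1#      ≈⟨ xy≈1 ⟨
    x * y   ≤⟨ *-monoˡ-≤ 0≤x y≤0 ⟩
    x * 0#  ≈⟨ zeroʳ x ⟩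
    0#      ∎))
    where open ≤-Reasoning

  x⁻¹*[x*y]≈y : ∀ {x} y → 0# < x → x ⁻¹ * (x * y) ≈ y
  x⁻¹*[x*y]≈y {x} y 0<x = trans
    (solve 3 (λ i x y → i :* (x :* y) := (x :* i) :* y) refl (x ⁻¹) x y)
    (trans (*-congʳ (*-inverseʳ (pos⇒≉0 0<x))) (*-identityˡ y))

  x*[x⁻¹*y]≈y : ∀ {x} y → 0# < x → x * (x ⁻¹ * y) ≈ y
  x*[x⁻¹*y]≈y {x} y 0<x = trans (sym (*-assoc x _ y))
    (trans (*-congʳ (*-inverseʳ (pos⇒≉0 0<x))) (*-identityˡ y))

  *-cancelˡ-≤ : ∀ {z x y} → 0# < z → z * x ≤ z * y → x ≤ y
  *-cancelˡ-≤ {z} {x} {y} 0<z zx≤zy = begin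
    x               ≈⟨ x⁻¹*[x*y]≈y x 0<z ⟨
    z ⁻¹ * (z * x)  ≤⟨ *-monoˡ-≤ (⁻¹-nonneg (proj₁ 0<z)) zx≤zy ⟩
    z ⁻¹ * (z * y)  ≈⟨ x⁻¹*[x*y]≈y y 0<z ⟩
    y               ∎
    where open ≤-Reasoning

  *-cancelˡ-< : ∀ {z x y} → 0# ≤ z → z * x < z * y → x < y
  *-cancelˡ-< 0≤z zx<zy = ≰⇒> λ y≤x → <⇒≱ zx<zy (*-monoˡ-≤ 0≤z y≤x)

  *-monoˡ-< : ∀ {z x y} → 0# < z → x < y → z * x < z * y
  *-monoˡ-< 0<z x<y = ≰⇒> λ zy≤zx → <⇒≱ x<y (*-cancelˡ-≤ 0<z zy≤zx)

  *-pos : ∀ {x y} → 0# < x → 0# < y → 0# < x * y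
  *-pos {x} {y} 0<x 0<y = ≰⇒> λ xy≤0 →
    <⇒≱ 0<y (*-cancelˡ-≤ 0<x (≤-trans xy≤0 (≤-reflexive (sym (zeroʳ x)))))

  -- Powers with natural exponents

  ^-nonneg : ∀ {x} → 0# ≤ x → ∀ n → 0# ≤ x ^ n
  ^-nonneg 0≤x zero    = 0≤1
  ^-nonneg 0≤x (suc n) = *-nonneg 0≤x (^-nonneg 0≤x n)

  ^-pos : ∀ {x} → 0# < x → ∀ n → 0# < x ^ n
  ^-pos 0<x zero    = 0<1
  ^-pos 0<x (suc n) = *-pos 0<x (^-pos 0<x n)

  ^-monoˡ-≤ : ∀ {x y} → 0# ≤ x → x ≤ y → ∀ n → x ^ n ≤ y ^ n
  ^-monoˡ-≤ 0≤x x≤y zero    = ≤-refl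
  ^-monoˡ-≤ 0≤x x≤y (suc n) = *-mono-≤ 0≤x x≤y (^-nonneg 0≤x n) (^-monoˡ-≤ 0≤x x≤y n)

  1^n≈1 : ∀ n → 1# ^ n ≈ 1#
  1^n≈1 zero    = refl
  1^n≈1 (suc n) = trans (*-identityˡ _) (1^n≈1 n)

  1≤x⇒1≤x^n : ∀ {x} → 1# ≤ x → ∀ n → 1# ≤ x ^ n
  1≤x⇒1≤x^n 1≤x n = ≤-trans (≤-reflexive (sym (1^n≈1 n))) (^-monoˡ-≤ 0≤1 1≤x n)

  x≤1⇒x^n≤1 : ∀ {x} → 0# ≤ x → x ≤ 1# → ∀ n → x ^ n ≤ 1#
  x≤1⇒x^n≤1 0≤x x≤1 n = ≤-trans (^-monoˡ-≤ 0≤x x≤1 n) (≤-reflexive (1^n≈1 n))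

  ^-cancelʳ-≤ : ∀ {x y} → 0# ≤ y → ∀ n → x ^ suc n ≤ y ^ suc n → x ≤ y
  ^-cancelʳ-≤ {x} {y} 0≤y n le = ≮⇒≥ λ y<x → <⇒≱ (strictly y<x) le
    where
    open ≤-Reasoning
    strictly : y < x → y * y ^ n < x * x ^ n
    strictly y<x = begin-strict
      y * y ^ n  ≤⟨ *-monoˡ-≤ 0≤y (^-monoˡ-≤ 0≤y (proj₁ y<x) n) ⟩
      y * x ^ n  ≈⟨ *-comm y _ ⟩
      x ^ n * y  <⟨ *-monoˡ-< (^-pos 0<x n) y<x ⟩
      x ^ n * x  ≈⟨ *-comm _ x ⟩
      x * x ^ n  ∎
      where
      0<x : 0# < x
      0<x = ≰⇒> λ x≤0 → <⇒≱ y<x (≤-trans x≤0 0≤y)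

  -- Bernoulli's inequality

  2wz≤w²+z²-ordered : ∀ {w z} → w ≤ z → 2# * (w * z) ≤ w * w + z * z
  2wz≤w²+z²-ordered {w} {z} w≤z with ≤⇒+ w≤z
  ... | h , 0≤h , z≈w+h = begin
    2# * (w * z)                ≈⟨ *-congˡ (*-congˡ z≈w+h) ⟩
    2# * (w * (w + h))          ≤⟨ x≤x+y (*-nonneg 0≤h 0≤h) ⟩
    2# * (w * (w + h)) + h * h  ≈⟨ solve 2 (λ w h → con 2 :* (w :* (w :+ h)) :+ h :* h
                                     := w :* w :+ (w :+ h) :* (w :+ h)) refl w h ⟩
    w * w + (w + h) * (w + h)   ≈⟨ +-congˡ (*-cong z≈w+h z≈w+h) ⟨
    w * w + z * z               ∎
    where open ≤-Reasoning

  2wz≤w²+z² : ∀ w z → 2# * (w * z) ≤ w * w + z * z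
  2wz≤w²+z² w z with total w z
  ... | inj₁ w≤z = 2wz≤w²+z²-ordered w≤z
  ... | inj₂ z≤w = begin
    2# * (w * z)   ≈⟨ *-congˡ (*-comm w z) ⟩
    2# * (z * w)   ≤⟨ 2wz≤w²+z²-ordered z≤w ⟩
    z * z + w * w  ≈⟨ +-comm (z * z) (w * w) ⟩
    w * w + z * z  ∎
    where open ≤-Reasoning

  fromℕ : ℕ → ℝ
  fromℕ n = n ⊗ 1#

  0≤fromℕ : ∀ n → 0# ≤ fromℕ n
  0≤fromℕ zero    = ≤-refl
  0≤fromℕ (suc n) = +-nonneg 0≤1 (0≤fromℕ n)

  0<fromℕ[1+n] : ∀ n → 0# < fromℕ (suc n)
  0<fromℕ[1+n] n = <-≤-trans 0<1 (x≤x+y (0≤fromℕ n))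

  -- The homogeneous, division-free form: AM-GM for `w ^ suc n` and n copies of `z ^ suc n`. The
  -- induction step multiplies the previous case by `w` and uses `2wz≤w²+z²`; adding the same term
  -- to both sides replaces a subtraction.
  bernoulli : ∀ {w z} → 0# ≤ w → 0# ≤ z → ∀ n →
              fromℕ (suc n) * (w * z ^ n) ≤ w ^ suc n + fromℕ n * z ^ suc n
  bernoulli {w} {z} _ _ zero = ≤-reflexive
    (solve 2 (λ w z → (con 1 :+ con 0) :* (w :* con 1) := w :* con 1 :+ con 0 :* (z :* con 1)) refl w z)
  bernoulli {w} {z} 0≤w 0≤z (suc n) = +-cancelʳ-≤ (w * (N * (z * Z))) (begin
    (1# + (1# + N)) * (w * (z * Z)) + w * (N * (z * Z))
      ≈⟨ solve 4 (λ w z N Z → (con 1 :+ (con 1 :+ N)) :* (w :* (z :* Z)) :+ w :* (N :* (z :* Z))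
           := ((con 1 :+ N) :* Z) :* (con 2 :* (w :* z))) refl w z N Z ⟩
    ((1# + N) * Z) * (2# * (w * z))
      ≤⟨ *-monoˡ-≤ (*-nonneg (0≤fromℕ (suc n)) (^-nonneg 0≤z n)) (2wz≤w²+z² w z) ⟩
    ((1# + N) * Z) * (w * w + z * z)
      ≈⟨ solve 4 (λ w z N Z → ((con 1 :+ N) :* Z) :* (w :* w :+ z :* z)
           := w :* ((con 1 :+ N) :* (w :* Z)) :+ (con 1 :+ N) :* (z :* (z :* Z))) refl w z N Z ⟩
    w * ((1# + N) * (w * Z)) + (1# + N) * (z * (z * Z))
      ≤⟨ +-monoˡ-≤ _ (*-monoˡ-≤ 0≤w (bernoulli 0≤w 0≤z n)) ⟩
    w * (w * W + N * (z * Z)) + (1# + N) * (z * (z * Z))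
      ≈⟨ solve 5 (λ w z N Z W → w :* (w :* W :+ N :* (z :* Z)) :+ (con 1 :+ N) :* (z :* (z :* Z))
           := w :* (w :* W) :+ (con 1 :+ N) :* (z :* (z :* Z)) :+ w :* (N :* (z :* Z))) refl w z N Z W ⟩
    w * (w * W) + (1# + N) * (z * (z * Z)) + w * (N * (z * Z)) ∎)
    where
    open ≤-Reasoning
    N Z W : ℝ
    N = fromℕ n
    Z = z ^ n
    W = w ^ n

  -- The Archimedean property and limiting arguments

  ∀-fromℕ≤⇒⊥ : ∀ x → ¬ (∀ n → fromℕ n ≤ x)
  ∀-fromℕ≤⇒⊥ x bounded with complete (λ y → ∃ λ n → y ≈ fromℕ n) (0# , 0 , refl)
                                (x , λ _ (n , y≈n) → ≤-trans (≤-reflexive y≈n) (bounded n))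
  ... | s , ub , least = <⇒≱ 0<1 (+-cancelʳ-≤ s (begin
    1# + s         ≤⟨ +-monoʳ-≤ 1# (least (s - 1#) ub-1) ⟩
    1# + (s - 1#)  ≈⟨ +-comm 1# _ ⟩
    (s - 1#) + 1#  ≈⟨ x-y+y≈x s 1# ⟩
    s              ≈⟨ +-identityˡ s ⟨
    0# + s         ∎))
    where
    open ≤-Reasoning
    -- The successor of a natural number is again one, so the least upper bound could be lowered by
    -- 1.
    ub-1 : ∀ y → (∃ λ n → y ≈ fromℕ n) → y ≤ s - 1#
    ub-1 y (n , y≈n) = +-cancelʳ-≤ 1# (begin
      y + 1#         ≈⟨ +-congʳ y≈n ⟩
      fromℕ n + 1#   ≈⟨ +-comm _ 1# ⟩
      fromℕ (suc n)  ≤⟨ ub _ (suc n , refl) ⟩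
      s              ≈⟨ x-y+y≈x s 1# ⟨
      (s - 1#) + 1#  ∎)

  abstract
    archimedean : ∀ x → ∃ λ n → x ≤ fromℕ n
    archimedean x with lem {∃ λ n → x ≤ fromℕ n}
    ... | yes ∃n = ∃n
    ... | no ∄n  = ⊥-elim (∀-fromℕ≤⇒⊥ x λ n → proj₁ (≰⇒> λ x≤n → ∄n (n , x≤n)))

  abstract
    -- Descent from an Archimedean bound. Both inequalities are non-strict, so `total` decides each
    -- step.
    floor : ∀ {x} → 0# ≤ x → ∃ λ n → fromℕ n ≤ x × x ≤ fromℕ (suc n)
    floor {x} 0≤x with archimedean x
    ... | N , x≤N = below N (≤-trans x≤N (≤-trans (x≤x+y 0≤1) (≤-reflexive (+-comm _ 1#))))
      where
      below : ∀ N → x ≤ fromℕ (suc N) → ∃ λ n → fromℕ n ≤ x × x ≤ fromℕ (suc n)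
      below zero x≤1 = 0 , 0≤x , x≤1
      below (suc N) x≤N with total x (fromℕ (suc N))
      ... | inj₁ x≤N-1 = below N x≤N-1
      ... | inj₂ N-1≤x = suc N , N-1≤x , x≤N

  -- By Bernoulli, S^(n+1) ≥ s^n (s + (n+1)(S - s)).
  abstract
    ^-growth : ∀ {s S} c → 0# ≤ s → s < S → ∃ λ n → s ^ suc n * c ≤ S ^ suc n
    ^-growth {s} {S} c 0≤s s<S with ≤⇒+ (proj₁ s<S)
    ... | h , 0≤h , S≈s+h with archimedean (h ⁻¹ * (s * c))
    ...   | n , large = n , +-cancelʳ-≤ (N * (s * s ^ n)) (begin
      s * s ^ n * c + N * (s * s ^ n)
        ≈⟨ solve 4 (λ s sn c N → s :* sn :* c :+ N :* (s :* sn) := sn :* (s :* c) :+ N :* (s :* sn)) refl s (s ^ n) c N ⟩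
      s ^ n * (s * c) + N * (s * s ^ n)
        ≤⟨ +-monoˡ-≤ _ (*-monoˡ-≤ (^-nonneg 0≤s n) sc≤[1+N]h+s) ⟩
      s ^ n * ((1# + N) * h + s) + N * (s * s ^ n)
        ≈⟨ solve 4 (λ s sn h N → sn :* ((con 1 :+ N) :* h :+ s) :+ N :* (s :* sn)
             := (con 1 :+ N) :* ((s :+ h) :* sn)) refl s (s ^ n) h N ⟩
      (1# + N) * ((s + h) * s ^ n)
        ≈⟨ *-congˡ (*-congʳ S≈s+h) ⟨
      (1# + N) * (S * s ^ n)
        ≤⟨ bernoulli (≤-trans 0≤s (proj₁ s<S)) 0≤s n ⟩
      S ^ suc n + N * (s * s ^ n) ∎)
      where
      open ≤-Reasoning
      N : ℝ
      N = fromℕ n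
      0<h : 0# < h
      0<h = 0≤h , λ 0≈h → proj₂ s<S (sym (trans S≈s+h (trans (+-congˡ (sym 0≈h)) (+-identityʳ s))))
      sc≤[1+N]h+s : s * c ≤ (1# + N) * h + s
      sc≤[1+N]h+s = begin
        s * c                 ≈⟨ x*[x⁻¹*y]≈y (s * c) 0<h ⟨
        h * (h ⁻¹ * (s * c))  ≤⟨ *-monoˡ-≤ 0≤h large ⟩
        h * N                 ≈⟨ *-comm h N ⟩
        N * h                 ≤⟨ *-monoʳ-≤ 0≤h (≤-trans (x≤x+y 0≤1) (≤-reflexive (+-comm N 1#))) ⟩
        (1# + N) * h          ≤⟨ x≤x+y 0≤s ⟩
        (1# + N) * h + s      ∎

  -- If y < x, their midpoint refutes the hypothesis. The gap between `s` and `x` is what later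
  -- absorbs, via `^-growth`, the constant factors lost in rounding exponents.
  ≤-dense : ∀ {x y} → 0# ≤ y → (∀ s → 0# ≤ s → s < x → s ≤ y) → x ≤ y
  ≤-dense {x} {y} 0≤y approx = ≮⇒≥ λ y<x → <⇒≱ y<x (close y<x)
    where
    open ≤-Reasoning
    close : y < x → x ≤ y
    close y<x = +-cancelʳ-≤ y (begin
      x + y      ≈⟨ solve 2 (λ x y → x :+ y := y :+ x) refl x y ⟩
      y + x      ≈⟨ 2*mid ⟨
      2# * mid   ≤⟨ *-monoˡ-≤ 0≤2 (approx mid 0≤mid mid<x) ⟩
      2# * y     ≈⟨ solve 1 (λ y → con 2 :* y := y :+ y) refl y ⟩
      y + y      ∎)
      where
      mid : ℝ
      mid = 2# ⁻¹ * (y + x)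
      2*mid : 2# * mid ≈ y + x
      2*mid = x*[x⁻¹*y]≈y (y + x) 0<2
      0≤mid : 0# ≤ mid
      0≤mid = *-nonneg (⁻¹-nonneg 0≤2) (+-nonneg 0≤y (≤-trans 0≤y (proj₁ y<x)))
      mid<x : mid < x
      mid<x = ≰⇒> λ x≤mid → <⇒≱ y<x (+-cancelʳ-≤ x (begin
        x + x      ≈⟨ solve 1 (λ y → con 2 :* y := y :+ y) refl x ⟨
        2# * x     ≤⟨ *-monoˡ-≤ 0≤2 x≤mid ⟩
        2# * mid   ≈⟨ 2*mid ⟩
        y + x      ∎))

  -- Rational exponents and substitutes for roots

  fromℕ-mono-≤ : ∀ {k m} → k ℕ.≤ m → fromℕ k ≤ fromℕ m
  fromℕ-mono-≤ {m = m} ℕ.z≤n = 0≤fromℕ m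
  fromℕ-mono-≤ (ℕ.s≤s k≤m)   = +-monoʳ-≤ 1# (fromℕ-mono-≤ k≤m)

  fromℕ-cancel-≤ : ∀ k m → fromℕ k ≤ fromℕ m → k ℕ.≤ m
  fromℕ-cancel-≤ k m le with k ℕₚ.≤? m
  ... | yes k≤m = k≤m
  ... | no  k≰m = ⊥-elim (<⇒≱ 0<1 (+-cancelʳ-≤ (fromℕ m) (begin
    1# + fromℕ m  ≤⟨ fromℕ-mono-≤ (ℕₚ.≰⇒> k≰m) ⟩
    fromℕ k       ≤⟨ le ⟩
    fromℕ m       ≈⟨ +-identityˡ _ ⟨
    0# + fromℕ m  ∎)))
    where open ≤-Reasoning

  ⊗≈fromℕ* : ∀ n x → n ⊗ x ≈ fromℕ n * x
  ⊗≈fromℕ* n x = sym (trans (×-assoc-* n 1# x) (×-congʳ n (*-identityˡ x)))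

  ^-monoʳ-≤ : ∀ {x} → 1# ≤ x → ∀ {k m} → k ℕ.≤ m → x ^ k ≤ x ^ m
  ^-monoʳ-≤ 1≤x {m = m} ℕ.z≤n = 1≤x⇒1≤x^n 1≤x m
  ^-monoʳ-≤ 1≤x (ℕ.s≤s k≤m)   = *-monoˡ-≤ (≤-trans 0≤1 1≤x) (^-monoʳ-≤ 1≤x k≤m)

  -- (1 + y/n)ⁿ is nondecreasing in n, for z = 1 + y/(1+n) and w = 1 + y/(k+1+n).
  rational-bernoulli : ∀ n k {z w} → 0# ≤ z →
    fromℕ (suc n) * z + fromℕ k ≈ fromℕ (k ℕ.+ suc n) * w →
    z ^ suc n ≤ w ^ (k ℕ.+ suc n)
  rational-bernoulli n zero {z} {w} 0≤z eq = ^-monoˡ-≤ 0≤z (*-cancelˡ-≤ (0<fromℕ[1+n] n)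
    (≤-reflexive (trans (sym (+-identityʳ _)) eq))) (suc n)
  rational-bernoulli n (suc k) {z} {w} 0≤z eq =
    ≤-trans (rational-bernoulli n k 0≤z (sym Fw′≈)) w′^F≤w^[1+F]
    where
    open ≤-Reasoning
    m : ℕ
    m = k ℕ.+ suc n
    F w′ : ℝ
    F = fromℕ m
    -- This is 1 + y/m, the base belonging to the exponent one below that of `w`.
    w′ = F ⁻¹ * (fromℕ (suc n) * z + fromℕ k)
    0<F : 0# < F
    0<F = <-≤-trans (0<fromℕ[1+n] n) (fromℕ-mono-≤ (ℕₚ.m≤n+m (suc n) k))
    Fw′≈ : F * w′ ≈ fromℕ (suc n) * z + fromℕ k
    Fw′≈ = x*[x⁻¹*y]≈y _ 0<F
    0≤w′ : 0# ≤ w′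
    0≤w′ = *-nonneg (⁻¹-nonneg (proj₁ 0<F)) (+-nonneg (*-nonneg (0≤fromℕ (suc n)) 0≤z) (0≤fromℕ k))
    [1+F]w≈ : (1# + F) * w ≈ 1# + F * w′
    [1+F]w≈ = trans (sym eq) (trans
      (solve 2 (λ a k → a :+ (con 1 :+ k) := con 1 :+ (a :+ k)) refl _ (fromℕ k)) (+-congˡ (sym Fw′≈)))
    0≤w : 0# ≤ w
    0≤w = *-cancelˡ-≤ (0<fromℕ[1+n] m) (begin
      (1# + F) * 0#  ≈⟨ zeroʳ _ ⟩
      0#             ≤⟨ +-nonneg 0≤1 (*-nonneg (proj₁ 0<F) 0≤w′) ⟩
      1# + F * w′    ≈⟨ [1+F]w≈ ⟨
      (1# + F) * w   ∎)
    w′^F≤w^[1+F] : w′ ^ m ≤ w ^ suc m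
    w′^F≤w^[1+F] = +-cancelʳ-≤ (F * (w′ * w′ ^ m)) (begin
      w′ ^ m + F * (w′ * w′ ^ m)
        ≈⟨ solve 3 (λ p F w′ → p :+ F :* (w′ :* p) := (con 1 :+ F :* w′) :* p) refl (w′ ^ m) F w′ ⟩
      (1# + F * w′) * w′ ^ m          ≈⟨ *-congʳ [1+F]w≈ ⟨
      (1# + F) * w * w′ ^ m           ≈⟨ *-assoc _ w _ ⟩
      (1# + F) * (w * w′ ^ m)         ≤⟨ bernoulli 0≤w 0≤w′ m ⟩
      w ^ suc m + F * (w′ * w′ ^ m)   ∎)

  abstract
    -- A substitute for continuity of the n-th power at `t`: `K` does not depend on `h`, and
    -- `h ≤ 1#` turns the quadratic term of the induction into a linear one.
    ^-locally-lipschitz : ∀ {t} → 0# ≤ t → ∀ n → ∃ λ K → 0# ≤ K ×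
      (∀ h → 0# ≤ h → h ≤ 1# → (t + h) ^ n ≤ t ^ n + h * K)
    ^-locally-lipschitz 0≤t zero = 0# , ≤-refl , λ h _ _ →
      ≤-reflexive (solve 1 (λ h → con 1 := con 1 :+ h :* con 0) refl h)
    ^-locally-lipschitz {t} 0≤t (suc n) with ^-locally-lipschitz 0≤t n
    ... | K , 0≤K , bound = t ^ n + t * K + K ,
      +-nonneg (+-nonneg (^-nonneg 0≤t n) (*-nonneg 0≤t 0≤K)) 0≤K , λ h 0≤h h≤1 → begin
        (t + h) * (t + h) ^ n                ≤⟨ *-monoˡ-≤ (+-nonneg 0≤t 0≤h) (bound h 0≤h h≤1) ⟩
        (t + h) * (t ^ n + h * K)            ≈⟨ solve 4 (λ t h p K → (t :+ h) :* (p :+ h :* K)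
                                                  := t :* p :+ h :* (p :+ t :* K :+ h :* K)) refl t h (t ^ n) K ⟩
        t * t ^ n + h * (t ^ n + t * K + h * K)
          ≤⟨ +-monoʳ-≤ _ (*-monoˡ-≤ 0≤h (+-monoʳ-≤ _ (≤-trans (*-monoʳ-≤ 0≤K h≤1) (≤-reflexive (*-identityˡ K))))) ⟩
        t * t ^ n + h * (t ^ n + t * K + K)  ∎
      where open ≤-Reasoning

  -- No root of `c` has to be constructed: if t^n < c, a slightly larger t + h still satisfies (t +
  -- h)^n ≤ c, against the hypothesis.
  ≤-^-from-roots : ∀ {t c} → 0# ≤ t → ∀ n → (∀ y → 0# ≤ y → y ^ n ≤ c → y ≤ t) → c ≤ t ^ n
  ≤-^-from-roots {t} {c} 0≤t n roots≤t = ≮⇒≥ λ t^n<c → contra t^n<c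
    where
    open ≤-Reasoning
    contra : ¬ (t ^ n < c)
    contra t^n<c@(t^n≤c , t^n≉c) with ≤⇒+ t^n≤c | ^-locally-lipschitz 0≤t n
    ... | g , 0≤g , c≈t^n+g | K , 0≤K , bound =
      <⇒≱ 0<h (+-cancelʳ-≤ t (begin
        h + t   ≈⟨ +-comm h t ⟩
        t + h   ≤⟨ roots≤t (t + h) (+-nonneg 0≤t 0≤h) (begin
                     (t + h) ^ n    ≤⟨ bound h 0≤h h≤1 ⟩
                     t ^ n + h * K  ≤⟨ +-monoʳ-≤ _ hK≤g ⟩
                     t ^ n + g      ≈⟨ c≈t^n+g ⟨
                     c              ∎) ⟩
        t       ≈⟨ +-identityˡ t ⟨
        0# + t  ∎))
      where
      h : ℝ
      -- This choice gives both h ≤ 1 and h K ≤ g, so the Lipschitz bound stays within the gap `g`.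
      h = (g + K) ⁻¹ * g
      0<g : 0# < g
      0<g = 0≤g , λ 0≈g → t^n≉c (sym (trans c≈t^n+g (trans (+-congˡ (sym 0≈g)) (+-identityʳ _))))
      0<g+K : 0# < g + K
      0<g+K = <-≤-trans 0<g (x≤x+y 0≤K)
      0≤i : 0# ≤ (g + K) ⁻¹
      0≤i = ⁻¹-nonneg (proj₁ 0<g+K)
      [g+K]h≈g : (g + K) * h ≈ g
      [g+K]h≈g = x*[x⁻¹*y]≈y g 0<g+K
      0≤h : 0# ≤ h
      0≤h = *-nonneg 0≤i 0≤g
      0<h : 0# < h
      0<h = *-cancelˡ-< (proj₁ 0<g+K) (begin-strict
        (g + K) * 0#  ≈⟨ zeroʳ _ ⟩
        0#            <⟨ 0<g ⟩
        g             ≈⟨ [g+K]h≈g ⟨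
        (g + K) * h   ∎)
      h≤1 : h ≤ 1#
      h≤1 = *-cancelˡ-≤ 0<g+K (begin
        (g + K) * h   ≈⟨ [g+K]h≈g ⟩
        g             ≤⟨ x≤x+y 0≤K ⟩
        g + K         ≈⟨ *-identityʳ _ ⟨
        (g + K) * 1#  ∎)
      hK≤g : h * K ≤ g
      hK≤g = begin
        h * K          ≤⟨ x≤x+y (*-nonneg 0≤h 0≤g) ⟩
        h * K + h * g  ≈⟨ solve 3 (λ h K g → h :* K :+ h :* g := (g :+ K) :* h) refl h K g ⟩
        (g + K) * h    ≈⟨ [g+K]h≈g ⟩
        g              ∎

  -- Suprema with values in (-∞,∞]

  ≤∞-reflexive : ∀ {s t} → s ≡ t → s ≤∞ t
  ≤∞-reflexive {⊤⁺}    ≡.refl = _ Add≤.≤⊤⁺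
  ≤∞-reflexive {[ _ ]} ≡.refl = Add≤.[ ≤-refl ]

  ≤∞-trans : ∀ {x y z} → x ≤∞ y → y ≤∞ z → x ≤∞ z
  ≤∞-trans = Add≤.≤⁺-trans _≤_ ≤-trans

  ∈⇒≤sup : ∀ {S x} → S x → [ x ] ≤∞ sup S
  ∈⇒≤sup {S} {x} x∈S with lem {Satisfiable (IsLub S)}
  ... | yes (s , ub , _) = Add≤.[ ub x x∈S ]
  ... | no  _            = [ x ] Add≤.≤⊤⁺

  sup≤ : ∀ {S u} → Satisfiable S → UpperBound S u → sup S ≤∞ [ u ]
  sup≤ {S} {u} S≢∅ ub with lem {Satisfiable (IsLub S)}
  ... | yes (_ , _ , least) = Add≤.[ least u ub ]
  ... | no  ∄lub            = ⊥-elim (∄lub (complete S S≢∅ (u , ub)))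

  -- Without a least upper bound `real` returns its default 0, which `0# ≤ u` covers; hence neither
  -- an element of `S` nor a separate case for the empty set is required.
  real-sup≤ : ∀ {S u} → 0# ≤ u → UpperBound S u → real (sup S) ≤ u
  real-sup≤ {S} {u} 0≤u ub with lem {Satisfiable (IsLub S)}
  ... | yes (_ , _ , least) = least u ub
  ... | no  _               = 0≤u

  ≤real-sup : ∀ {S x u} → S x → UpperBound S u → x ≤ real (sup S)
  ≤real-sup {S} {x} {u} x∈S ub with lem {Satisfiable (IsLub S)}
  ... | yes (_ , ub′ , _) = ub′ x x∈S
  ... | no  ∄lub          = ⊥-elim (∄lub (complete S (x , x∈S) (u , ub)))

  -- A negative least upper bound would force `S` to be empty, and then s - 1 would be a smaller
  -- upper bound.
  0≤real-sup : ∀ {S} → (∀ x → S x → 0# ≤ x) → 0# ≤ real (sup S)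
  0≤real-sup {S} nonneg with lem {Satisfiable (IsLub S)}
  ... | no _ = ≤-refl
  ... | yes (s , ub , least) = ≮⇒≥ λ s<0 → <⇒≱ 0<1 (+-cancelʳ-≤ s (begin
    1# + s         ≤⟨ +-monoʳ-≤ 1# (least (s - 1#) λ x x∈S → ⊥-elim (<⇒≱ s<0 (≤-trans (nonneg x x∈S) (ub x x∈S)))) ⟩
    1# + (s - 1#)  ≈⟨ +-comm 1# _ ⟩
    (s - 1#) + 1#  ≈⟨ x-y+y≈x s 1# ⟩
    s              ≈⟨ +-identityˡ s ⟨
    0# + s         ∎))
    where open ≤-Reasoning

  -- Real powers

  0≤pow : ∀ x p → 0# ≤ pow x p
  0≤pow x p = 0≤real-sup λ _ → proj₁

  -- The fraction k/(n+1) lies on the side of p on which x^(k/(n+1)) ≤ x^p. Multiples are written as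
  -- products with `fromℕ`, ready for field arithmetic.
  data Exponent (x p : ℝ) (k n : ℕ) : Set where
    below : 1# ≤ x → fromℕ k ≤ fromℕ (suc n) * p → Exponent x p k n
    above : x ≤ 1# → fromℕ (suc n) * p ≤ fromℕ k → Exponent x p k n

  BelowPower-intro : ∀ {x p y} → 0# ≤ y → ∀ {k n} → Exponent x p k n → y ^ suc n ≤ x ^ k → BelowPower x p y
  BelowPower-intro {p = p} 0≤y {k} {n} (below 1≤x k≤) le =
    0≤y , k , n , inj₁ (1≤x , ≤-trans k≤ (≤-reflexive (sym (⊗≈fromℕ* (suc n) p)))) , le
  BelowPower-intro {p = p} 0≤y {k} {n} (above x≤1 ≤k) le =
    0≤y , k , n , inj₂ (x≤1 , ≤-trans (≤-reflexive (⊗≈fromℕ* (suc n) p)) ≤k) , le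

  BelowPower-elim : ∀ {x p y} → BelowPower x p y →
    0# ≤ y × ∃₂ λ k n → Exponent x p k n × y ^ suc n ≤ x ^ k
  BelowPower-elim {p = p} (0≤y , k , n , inj₁ (1≤x , k≤) , le) =
    0≤y , k , n , below 1≤x (≤-trans k≤ (≤-reflexive (⊗≈fromℕ* (suc n) p))) , le
  BelowPower-elim {p = p} (0≤y , k , n , inj₂ (x≤1 , ≤k) , le) =
    0≤y , k , n , above x≤1 (≤-trans (≤-reflexive (sym (⊗≈fromℕ* (suc n) p))) ≤k) , le

  abstract
    -- For x ≤ 1 all members are at most 1; for x ≥ 1 an integer K ≥ p gives the bound x^K. The sum
    -- serves both cases.
    BelowPower-bounded : ∀ {x} p → 0# ≤ x → Satisfiable (UpperBound (BelowPower x p))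
    BelowPower-bounded {x} p 0≤x with archimedean p
    ... | K , p≤K = 1# + x ^ K , λ y y∈ → bound y (BelowPower-elim y∈)
      where
      open ≤-Reasoning
      0≤x^K : 0# ≤ x ^ K
      0≤x^K = ^-nonneg 0≤x K
      bound : ∀ y → (0# ≤ y × ∃₂ λ k n → Exponent x p k n × y ^ suc n ≤ x ^ k) → y ≤ 1# + x ^ K
      bound y (0≤y , k , n , above x≤1 _ , le) = ≤-trans
        (^-cancelʳ-≤ 0≤1 n (≤-trans le (≤-trans (x≤1⇒x^n≤1 0≤x x≤1 k) (≤-reflexive (sym (1^n≈1 (suc n)))))))
        (x≤x+y 0≤x^K)
      bound y (0≤y , k , n , below 1≤x k≤ , le) = ^-cancelʳ-≤ (+-nonneg 0≤1 0≤x^K) n (begin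
        y ^ suc n             ≤⟨ le ⟩
        x ^ k                 ≤⟨ ^-monoʳ-≤ 1≤x (fromℕ-cancel-≤ k (K ℕ.* suc n) (begin
                                   fromℕ k                    ≤⟨ k≤ ⟩
                                   fromℕ (suc n) * p          ≤⟨ *-monoˡ-≤ (0≤fromℕ (suc n)) p≤K ⟩
                                   fromℕ (suc n) * fromℕ K    ≈⟨ *-comm _ _ ⟩
                                   fromℕ K * fromℕ (suc n)    ≈⟨ ×1-homo-* K (suc n) ⟨
                                   fromℕ (K ℕ.* suc n)        ∎)) ⟩
        x ^ (K ℕ.* suc n)     ≈⟨ ^-assocʳ x K (suc n) ⟨
        (x ^ K) ^ suc n       ≤⟨ ^-monoˡ-≤ 0≤x^K (≤-trans (x≤x+y 0≤1) (≤-reflexive (+-comm _ 1#))) (suc n) ⟩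
        (1# + x ^ K) ^ suc n  ∎)

  ≤pow : ∀ {x p y} → 0# ≤ x → 0# ≤ y → ∀ k n → Exponent x p k n → y ^ suc n ≤ x ^ k → y ≤ pow x p
  ≤pow {p = p} 0≤x 0≤y _ _ e le = ≤real-sup (BelowPower-intro 0≤y e le) (proj₂ (BelowPower-bounded p 0≤x))

  -- Every y with y^(n+1) ≤ x^k lies below `pow x p` by definition, so `≤-^-from-roots` applies.
  -- Later arguments with rational exponents rest on this bound.
  x^k≤pow^[1+n] : ∀ {x p} → 0# ≤ x → ∀ k n → Exponent x p k n → x ^ k ≤ pow x p ^ suc n
  x^k≤pow^[1+n] {x} {p} 0≤x k n e =
    ≤-^-from-roots (0≤pow x p) (suc n) λ y 0≤y le → ≤pow 0≤x 0≤y k n e le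

  1≤pow : ∀ {x p} → 1# ≤ x → 0# ≤ p → 1# ≤ pow x p
  1≤pow {x} {p} 1≤x 0≤p = ≤pow (≤-trans 0≤1 1≤x) 0≤1 0 0
    (below 1≤x (*-nonneg (0≤fromℕ 1) 0≤p)) (≤-reflexive (1^n≈1 1))

  0<2^[p-1] : ∀ {p} → 1# ≤ p → 0# < pow 2# (p - 1#)
  0<2^[p-1] 1≤p = <-≤-trans 0<1 (1≤pow 1≤2 (x≤y⇒0≤y-x 1≤p))

  x≤1⇒pow≤1 : ∀ {x} p → 0# ≤ x → x ≤ 1# → pow x p ≤ 1#
  x≤1⇒pow≤1 p 0≤x x≤1 = real-sup≤ 0≤1 λ { y (_ , k , n , _ , le) → ^-cancelʳ-≤ 0≤1 n
    (≤-trans le (≤-trans (x≤1⇒x^n≤1 0≤x x≤1 k) (≤-reflexive (sym (1^n≈1 (suc n)))))) }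

  -- An integer k ≥ p supplies the positive lower bound x^k.
  0<pow : ∀ {x p} → 0# < x → x ≤ 1# → 0# < pow x p
  0<pow {x} {p} 0<x x≤1 with archimedean p
  ... | k , p≤k = <-≤-trans (^-pos 0<x k) (≤-trans
    (x^k≤pow^[1+n] (proj₁ 0<x) k 0 (above x≤1 (≤-trans (≤-reflexive 1p≈p) p≤k)))
    (≤-reflexive (*-identityʳ _)))
    where
    1p≈p : fromℕ 1 * p ≈ p
    1p≈p = trans (*-congʳ (+-identityʳ 1#)) (*-identityˡ p)

  -- The bound 1 ≤ p excludes the exponent k = 0, for which 0^0 = 1 would enter the supremum.
  pow-zero : ∀ {x p} → x ≈ 0# → 1# ≤ p → pow x p ≤ 0#
  pow-zero {x} {p} x≈0 1≤p = real-sup≤ ≤-refl λ y y∈ → bound y (BelowPower-elim y∈)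
    where
    open ≤-Reasoning
    bound : ∀ y → (0# ≤ y × ∃₂ λ k n → Exponent x p k n × y ^ suc n ≤ x ^ k) → y ≤ 0#
    bound y (_ , _ , _ , below 1≤x _ , _) = ⊥-elim (<⇒≱ 0<1 (≤-trans 1≤x (≤-reflexive x≈0)))
    bound y (_ , zero , n , above _ ≤0 , _) = ⊥-elim (<⇒≱ (0<fromℕ[1+n] n) (begin
      fromℕ (suc n)       ≈⟨ *-identityʳ _ ⟨
      fromℕ (suc n) * 1#  ≤⟨ *-monoˡ-≤ (0≤fromℕ (suc n)) 1≤p ⟩
      fromℕ (suc n) * p   ≤⟨ ≤0 ⟩
      0#                  ∎))
    bound y (_ , suc k , n , above _ _ , le) = ^-cancelʳ-≤ ≤-refl n (begin
      y ^ suc n    ≤⟨ le ⟩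
      x * x ^ k    ≈⟨ *-congʳ x≈0 ⟩
      0# * x ^ k   ≈⟨ zeroˡ _ ⟩
      0#           ≈⟨ zeroˡ _ ⟨
      0# * 0# ^ n  ∎)

  -- Here `t` plays the role of x^(1/p). For a = ⌊(n+1)p⌋, one of a, a+1 is a valid numerator for
  -- t^p and the other occurs in the bound by `root`. The surplus factor `t` between them is
  -- absorbed by s < x, with n taken from `^-growth`.
  x≤pow[root] : ∀ {x p t} → 0# ≤ x → 1# ≤ p → 0# ≤ t →
    (∀ k n → Exponent x (p ⁻¹) k n → x ^ k ≤ t ^ suc n) →
    (1# ≤ x → 1# ≤ t) → (x ≤ 1# → t ≤ 1#) → (0# < x → x ≤ 1# → 0# < t) →
    x ≤ pow t p
  x≤pow[root] {x} {p} {t} 0≤x 1≤p 0≤t root 1≤x⇒1≤t x≤1⇒t≤1 0<x≤1⇒0<t =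
    ≤-dense (0≤pow t p) λ s 0≤s s<x → [ approx-above s 0≤s s<x , approx-below s 0≤s s<x ]′ (total 1# x)
    where
    open ≤-Reasoning
    0<p : 0# < p
    0<p = <-≤-trans 0<1 1≤p
    0≤q : 0# ≤ p ⁻¹
    0≤q = ⁻¹-nonneg (proj₁ 0<p)
    cancel-p : ∀ b → (b * p) * p ⁻¹ ≈ b
    cancel-p b = trans (*-assoc b p (p ⁻¹)) (trans (*-congˡ (*-inverseʳ (pos⇒≉0 0<p))) (*-identityʳ b))
    ⌊[1+_]p⌋ : ∀ n → ∃ λ a → fromℕ a ≤ fromℕ (suc n) * p × fromℕ (suc n) * p ≤ fromℕ (suc a)
    ⌊[1+ n ]p⌋ = floor (*-nonneg (0≤fromℕ (suc n)) (proj₁ 0<p))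

    approx-above : ∀ s → 0# ≤ s → s < x → 1# ≤ x → s ≤ pow t p
    approx-above s 0≤s s<x 1≤x = ≤pow 0≤t 0≤s a n (below 1≤t a≤bp) (*-cancelˡ-≤ (<-≤-trans 0<1 1≤t) (begin
      t * s ^ suc n  ≈⟨ *-comm t _ ⟩
      s ^ suc n * t  ≤⟨ proj₂ growth ⟩
      x ^ suc n      ≤⟨ root (suc n) a (below 1≤x (begin
                          fromℕ (suc n)             ≈⟨ cancel-p _ ⟨
                          fromℕ (suc n) * p * p ⁻¹  ≤⟨ *-monoʳ-≤ 0≤q bp≤1+a ⟩
                          fromℕ (suc a) * p ⁻¹      ∎)) ⟩
      t * t ^ a      ∎))
      where
      1≤t : 1# ≤ t
      1≤t = 1≤x⇒1≤t 1≤x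
      growth : ∃ λ n → s ^ suc n * t ≤ x ^ suc n
      growth = ^-growth t 0≤s s<x
      n a : ℕ
      n = proj₁ growth
      a = proj₁ ⌊[1+ n ]p⌋
      a≤bp : fromℕ a ≤ fromℕ (suc n) * p
      a≤bp = proj₁ (proj₂ ⌊[1+ n ]p⌋)
      bp≤1+a : fromℕ (suc n) * p ≤ fromℕ (suc a)
      bp≤1+a = proj₂ (proj₂ ⌊[1+ n ]p⌋)

    approx-below : ∀ s → 0# ≤ s → s < x → x ≤ 1# → s ≤ pow t p
    approx-below s 0≤s s<x x≤1 = ≤pow 0≤t 0≤s (suc a) n (above (x≤1⇒t≤1 x≤1) bp≤1+a) (begin
      s ^ suc n                ≈⟨ *-identityʳ _ ⟨
      s ^ suc n * 1#           ≈⟨ *-congˡ (*-inverseʳ (pos⇒≉0 0<t)) ⟨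
      s ^ suc n * (t * t ⁻¹)   ≈⟨ solve 3 (λ s t i → s :* (t :* i) := t :* (s :* i)) refl (s ^ suc n) t (t ⁻¹) ⟩
      t * (s ^ suc n * t ⁻¹)   ≤⟨ *-monoˡ-≤ 0≤t (proj₂ growth) ⟩
      t * x ^ suc n            ≤⟨ *-monoˡ-≤ 0≤t (xᵇ≤tᵃ a a≤bp) ⟩
      t * t ^ a                ∎)
      where
      0<t : 0# < t
      0<t = 0<x≤1⇒0<t (≰⇒> λ x≤0 → <⇒≱ s<x (≤-trans x≤0 0≤s)) x≤1
      growth : ∃ λ n → s ^ suc n * t ⁻¹ ≤ x ^ suc n
      growth = ^-growth (t ⁻¹) 0≤s s<x
      n a : ℕ
      n = proj₁ growth
      a = proj₁ ⌊[1+ n ]p⌋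
      a≤bp : fromℕ a ≤ fromℕ (suc n) * p
      a≤bp = proj₁ (proj₂ ⌊[1+ n ]p⌋)
      bp≤1+a : fromℕ (suc n) * p ≤ fromℕ (suc a)
      bp≤1+a = proj₂ (proj₂ ⌊[1+ n ]p⌋)
      xᵇ≤tᵃ : ∀ a → fromℕ a ≤ fromℕ (suc n) * p → x ^ suc n ≤ t ^ a
      -- `root` needs a positive denominator, so a = 0 is treated separately: t^0 = 1.
      xᵇ≤tᵃ zero    _    = x≤1⇒x^n≤1 0≤x x≤1 (suc n)
      xᵇ≤tᵃ (suc a) a≤bp = root (suc n) a (above x≤1 (begin
        fromℕ (suc a) * p ⁻¹       ≤⟨ *-monoʳ-≤ 0≤q a≤bp ⟩
        fromℕ (suc n) * p * p ⁻¹   ≈⟨ cancel-p _ ⟩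
        fromℕ (suc n)              ∎))

  -- Undoes the p-th root in the norm, in the one direction that a lower bound for the distance
  -- requires.
  x≤pow[pow] : ∀ {x p} → 0# ≤ x → 1# ≤ p → x ≤ pow (pow x (p ⁻¹)) p
  x≤pow[pow] {x} {p} 0≤x 1≤p = x≤pow[root] 0≤x 1≤p (0≤pow x (p ⁻¹)) (x^k≤pow^[1+n] 0≤x)
    (λ 1≤x → 1≤pow 1≤x (⁻¹-nonneg (≤-trans 0≤1 1≤p))) (x≤1⇒pow≤1 (p ⁻¹) 0≤x) 0<pow

  -- Convexity of the p-th power

  -- With b = n+1 and a = e+1+b, `z` is the value at 2u of the tangent at 1 to the function x^(a/b).
  -- The term 2 (2^(p-1) u^p) stands for (2u)^p, and `θ` pays for the rounding.
  pow-tangent : ∀ {p u θ z} n e → 0# ≤ u → u ≤ 1# → 0# ≤ θ → θ ^ suc n * 2# ≤ 1# →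
    fromℕ e ≤ fromℕ (suc n) * (p - 1#) → fromℕ (suc n) * (p - 1#) ≤ fromℕ (suc e) →
    fromℕ (suc n) * z + fromℕ (suc e) ≈ fromℕ (suc e ℕ.+ suc n) * (2# * u) →
    θ * z ≤ 2# * (pow 2# (p - 1#) * pow u p)
  pow-tangent {p} {u} {θ} {z} n e 0≤u u≤1 0≤θ θᵇ2≤1 e≤b[p-1] b[p-1]≤1+e z-eq =
    [ nonneg , nonpos ]′ (total 0# z)
    where
    open ≤-Reasoning
    A C : ℝ
    A = pow u p
    C = pow 2# (p - 1#)
    b a : ℕ
    b = suc n
    a = suc e ℕ.+ suc n
    0≤2CA : 0# ≤ 2# * (C * A)
    0≤2CA = *-nonneg 0≤2 (*-nonneg (0≤pow _ _) (0≤pow _ _))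
    2^e≤Cᵇ : 2# ^ e ≤ C ^ b
    2^e≤Cᵇ = x^k≤pow^[1+n] 0≤2 e n (below 1≤2 e≤b[p-1])
    u^a≤Aᵇ : u ^ a ≤ A ^ b
    u^a≤Aᵇ = x^k≤pow^[1+n] 0≤u a n (above u≤1 (begin
      fromℕ b * p                         ≈⟨ *-congˡ (x-y+y≈x p 1#) ⟨
      fromℕ b * ((p - 1#) + 1#)           ≈⟨ trans (distribˡ _ _ _) (+-congˡ (*-identityʳ _)) ⟩
      fromℕ b * (p - 1#) + fromℕ b        ≤⟨ +-monoˡ-≤ _ b[p-1]≤1+e ⟩
      fromℕ (suc e) + fromℕ b             ≈⟨ ×-homo-+ 1# (suc e) b ⟨
      fromℕ a                             ∎))
    -- `rational-bernoulli` needs z ≥ 0; the tangent is negative when u is small, and then the claim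
    -- is trivial.
    nonpos : z ≤ 0# → θ * z ≤ 2# * (C * A)
    nonpos z≤0 = begin
      θ * z         ≤⟨ *-monoˡ-≤ 0≤θ z≤0 ⟩
      θ * 0#        ≈⟨ zeroʳ θ ⟩
      0#            ≤⟨ 0≤2CA ⟩
      2# * (C * A)  ∎
    nonneg : 0# ≤ z → θ * z ≤ 2# * (C * A)
    nonneg 0≤z = ^-cancelʳ-≤ 0≤2CA n (begin
      (θ * z) ^ b                              ≈⟨ ^-distrib-* θ z b ⟩
      θ ^ b * z ^ b                            ≤⟨ *-monoˡ-≤ (^-nonneg 0≤θ b) (rational-bernoulli n (suc e) 0≤z z-eq) ⟩
      θ ^ b * (2# * u) ^ a                     ≈⟨ *-congˡ (^-distrib-* 2# u a) ⟩
      θ ^ b * (2# ^ a * u ^ a)                 ≈⟨ *-congˡ (*-congʳ (^-homo-* 2# (suc e) b)) ⟩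
      θ ^ b * (2# * 2# ^ e * 2# ^ b * u ^ a)
        ≈⟨ solve 5 (λ t x y w v → t :* (x :* y :* w :* v) := (t :* x) :* (w :* (y :* v)))
                                                    refl (θ ^ b) 2# (2# ^ e) (2# ^ b) (u ^ a) ⟩
      -- In 2^a = 2 · 2^e · 2^b the factor 2^e is bounded by C^b. The remaining 2 comes from
      -- rounding p-1 down for the base 2 but up for the base u, and θ^b cancels it.
      (θ ^ b * 2#) * (2# ^ b * (2# ^ e * u ^ a))
        ≤⟨ *-mono-≤ (*-nonneg (^-nonneg 0≤θ b) 0≤2) θᵇ2≤1
             (*-nonneg (^-nonneg 0≤2 b) (*-nonneg (^-nonneg 0≤2 e) (^-nonneg 0≤u a)))
             (*-monoˡ-≤ (^-nonneg 0≤2 b) (*-mono-≤ (^-nonneg 0≤2 e) 2^e≤Cᵇ (^-nonneg 0≤u a) u^a≤Aᵇ)) ⟩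
      1# * (2# ^ b * (C ^ b * A ^ b))          ≈⟨ *-identityˡ _ ⟩
      2# ^ b * (C ^ b * A ^ b)                 ≈⟨ *-congˡ (^-distrib-* C A b) ⟨
      2# ^ b * (C * A) ^ b                     ≈⟨ ^-distrib-* 2# (C * A) b ⟨
      (2# * (C * A)) ^ b                       ∎)

  1≤2^[p-1][u^p+v^p] : ∀ {p u v} → 1# ≤ p → 0# ≤ u → 0# ≤ v → 1# ≤ u + v →
    1# ≤ pow 2# (p - 1#) * (pow u p + pow v p)
  1≤2^[p-1][u^p+v^p] {p} {u} {v} 1≤p 0≤u 0≤v 1≤u+v =
    -- `pow-tangent` rounds p upwards, which gives a lower bound for u^p only if u ≤ 1. If u or v is
    -- at least 1, its power alone is at least 1.
    [ (λ 1≤u → large (≤-trans (1≤pow 1≤u 0≤p) (x≤x+y 0≤B)))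
    , (λ u≤1 → [ (λ 1≤v → large (≤-trans (1≤pow 1≤v 0≤p) (≤-trans (x≤x+y 0≤A) (≤-reflexive (+-comm _ _)))))
               , (λ v≤1 → ≤-dense 0≤C[A+B] (approx u≤1 v≤1)) ]′ (total 1# v)) ]′ (total 1# u)
    where
    open ≤-Reasoning
    A B C : ℝ
    A = pow u p
    B = pow v p
    C = pow 2# (p - 1#)
    0≤p : 0# ≤ p
    0≤p = ≤-trans 0≤1 1≤p
    0≤A : 0# ≤ A
    0≤A = 0≤pow u p
    0≤B : 0# ≤ B
    0≤B = 0≤pow v p
    0≤C[A+B] : 0# ≤ C * (A + B)
    0≤C[A+B] = *-nonneg (0≤pow 2# (p - 1#)) (+-nonneg 0≤A 0≤B)
    large : 1# ≤ A + B → 1# ≤ C * (A + B)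
    large 1≤A+B = begin
      1#           ≈⟨ *-identityʳ 1# ⟨
      1# * 1#      ≤⟨ *-mono-≤ 0≤1 (1≤pow 1≤2 (x≤y⇒0≤y-x 1≤p)) 0≤1 1≤A+B ⟩
      C * (A + B)  ∎
    approx : u ≤ 1# → v ≤ 1# → ∀ θ → 0# ≤ θ → θ < 1# → θ ≤ C * (A + B)
    approx u≤1 v≤1 θ 0≤θ θ<1 with ^-growth 2# 0≤θ θ<1
    ... | n , θᵇ2≤1ᵇ with floor (*-nonneg (0≤fromℕ (suc n)) (x≤y⇒0≤y-x 1≤p))
    ...   | e , e≤b[p-1] , b[p-1]≤1+e = *-cancelˡ-≤ 0<2 (begin
      2# * θ                      ≈⟨ *-comm 2# θ ⟩
      θ * 2#                      ≤⟨ *-monoˡ-≤ 0≤θ 2≤zu+zv ⟩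
      θ * (z u + z v)             ≈⟨ distribˡ θ _ _ ⟩
      θ * z u + θ * z v           ≤⟨ +-mono-≤ (tangent 0≤u u≤1) (tangent 0≤v v≤1) ⟩
      2# * (C * A) + 2# * (C * B)
        ≈⟨ solve 4 (λ t C A B → t :* (C :* A) :+ t :* (C :* B) := t :* (C :* (A :+ B))) refl 2# C A B ⟩
      2# * (C * (A + B))          ∎)
      where
      N E a : ℝ
      N = fromℕ (suc n)
      E = fromℕ (suc e)
      a = fromℕ (suc e ℕ.+ suc n)
      z : ℝ → ℝ
      z w = N ⁻¹ * (a * (2# * w) - E)
      z-eq : ∀ w → N * z w + E ≈ a * (2# * w)
      z-eq w = trans (+-congʳ (x*[x⁻¹*y]≈y _ (0<fromℕ[1+n] n))) (x-y+y≈x _ E)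
      tangent : ∀ {w} → 0# ≤ w → w ≤ 1# → θ * z w ≤ 2# * (C * pow w p)
      tangent {w} 0≤w w≤1 = pow-tangent n e 0≤w w≤1 0≤θ (≤-trans θᵇ2≤1ᵇ (≤-reflexive (1^n≈1 (suc n))))
        e≤b[p-1] b[p-1]≤1+e (z-eq w)
      -- The tangent is affine and increasing with value 1 at 1, and the mean of 2u and 2v is u + v
      -- ≥ 1.
      2≤zu+zv : 2# ≤ z u + z v
      2≤zu+zv = *-cancelˡ-≤ (0<fromℕ[1+n] n) (+-cancelʳ-≤ (E + E) (begin
        N * 2# + (E + E)
          ≈⟨ solve 2 (λ N E → N :* con 2 :+ (E :+ E) := (E :+ N) :* (con 2 :* con 1)) refl N E ⟩
        (E + N) * (2# * 1#)            ≈⟨ *-congʳ (×-homo-+ 1# (suc e) (suc n)) ⟨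
        a * (2# * 1#)                  ≤⟨ *-monoˡ-≤ (0≤fromℕ (suc e ℕ.+ suc n)) (*-monoˡ-≤ 0≤2 1≤u+v) ⟩
        a * (2# * (u + v))
          ≈⟨ solve 4 (λ a t u v → a :* (t :* (u :+ v)) := a :* (t :* u) :+ a :* (t :* v)) refl a 2# u v ⟩
        a * (2# * u) + a * (2# * v)    ≈⟨ +-cong (z-eq u) (z-eq v) ⟨
        (N * z u + E) + (N * z v + E)
          ≈⟨ solve 4 (λ N x y E → (N :* x :+ E) :+ (N :* y :+ E) := N :* (x :+ y) :+ (E :+ E)) refl N (z u) (z v) E ⟩
        N * (z u + z v) + (E + E)      ∎))

  -- Absolute values and arithmetic with infinite values

  x≤∣x∣ : ∀ x → x ≤ ∣ x ∣
  x≤∣x∣ x with total 0# x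
  ... | inj₁ _   = ≤-refl
  ... | inj₂ x≤0 = ≤-trans x≤0 (≤-trans (x≤y⇒0≤y-x x≤0) (≤-reflexive (+-identityˡ (- x))))

  -x≤∣x∣ : ∀ x → - x ≤ ∣ x ∣
  -x≤∣x∣ x with total 0# x
  ... | inj₁ 0≤x = ≤-trans (≤-trans (≤-reflexive (sym (+-identityˡ (- x))))
                     (≤-trans (+-monoˡ-≤ (- x) 0≤x) (≤-reflexive (-‿inverseʳ x)))) 0≤x
  ... | inj₂ _   = ≤-refl

  ∣x∣≤ : ∀ {x c} → x ≤ c → - x ≤ c → ∣ x ∣ ≤ c
  ∣x∣≤ {x} x≤c -x≤c with total 0# x
  ... | inj₁ _ = x≤c
  ... | inj₂ _ = -x≤c

  0≤∣x∣ : ∀ x → 0# ≤ ∣ x ∣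
  0≤∣x∣ x with total 0# x
  ... | inj₁ 0≤x = 0≤x
  ... | inj₂ x≤0 = ≤-trans (x≤y⇒0≤y-x x≤0) (≤-reflexive (+-identityˡ (- x)))

  <⊤⇒finite : ∀ {s} → s <∞ ⊤⁺ → ∃ λ r → s ≡ [ r ]
  <⊤⇒finite Add<.[ r ]<⊤⁺ = r , ≡.refl

  ≤∞⇒finite : ∀ {s u} → s ≤∞ [ u ] → ∃ λ r → s ≡ [ r ] × r ≤ u
  ≤∞⇒finite Add≤.[ r≤u ] = _ , ≡.refl , r≤u

  -- Testing against real upper bounds makes the infinite case vacuous, so a claim about a possibly
  -- divergent sum becomes one about real numbers.
  ≤∞-from-bounds : ∀ {r} s → (∀ u → s ≤∞ [ u ] → r ≤ u) → [ r ] ≤∞ s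
  ≤∞-from-bounds ⊤⁺    _     = _ Add≤.≤⊤⁺
  ≤∞-from-bounds [ s ] bound = Add≤.[ bound s Add≤.[ ≤-refl ] ]

  0≤÷ : ∀ {a b} → [ 0# ] ≤∞ a → [ 0# ] ≤∞ b → [ 0# ] ≤∞ a ÷ b
  0≤÷ {⊤⁺}          _           _           = _ Add≤.≤⊤⁺
  0≤÷ {[ _ ]} {⊤⁺}    _           _           = Add≤.[ ≤-refl ]
  0≤÷ {[ _ ]} {[ _ ]} Add≤.[ 0≤a ] Add≤.[ 0≤b ] = Add≤.[ *-nonneg 0≤a (⁻¹-nonneg 0≤b) ]

  ≤÷ : ∀ {r u} s → 0# < u → (∀ t → s ≤∞ [ t ] → r * u ≤ t) → [ r ] ≤∞ s ÷ [ u ]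
  ≤÷ ⊤⁺ _ _ = _ Add≤.≤⊤⁺
  ≤÷ {r} {u} [ s ] 0<u bound = Add≤.[ *-cancelˡ-≤ 0<u (begin
    u * r           ≈⟨ *-comm u r ⟩
    r * u           ≤⟨ bound s Add≤.[ ≤-refl ] ⟩
    s               ≈⟨ x⁻¹*[x*y]≈y s 0<u ⟨
    u ⁻¹ * (u * s)  ≈⟨ solve 3 (λ i u s → i :* (u :* s) := u :* (s :* i)) refl (u ⁻¹) u s ⟩
    u * (s * u ⁻¹)  ∎) ]
    where open ≤-Reasoning

  ÷-bound : ∀ {a n r e u} → 0# ≤ r → 0# ≤ e → 0# < u → a ≤∞ [ e ] → [ u ] ≤∞ n →
            [ r ] ≤∞ a ÷ n → r * u ≤ e
  -- Dividing by an infinite distance gives 0 by convention, which forces r ≤ 0.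
  ÷-bound {n = ⊤⁺} {r} {e} {u} _ 0≤e 0<u Add≤.[ _ ] _ Add≤.[ r≤0 ] = begin
    r * u   ≤⟨ *-monoʳ-≤ (proj₁ 0<u) r≤0 ⟩
    0# * u  ≈⟨ zeroˡ u ⟩
    0#      ≤⟨ 0≤e ⟩
    e       ∎
    where open ≤-Reasoning
  ÷-bound {[ a ]} {[ n ]} {r} {e} {u} 0≤r 0≤e 0<u Add≤.[ a≤e ] Add≤.[ u≤n ] Add≤.[ r≤a/n ] = begin
    r * u           ≤⟨ *-monoˡ-≤ 0≤r u≤n ⟩
    r * n           ≤⟨ *-monoʳ-≤ (proj₁ 0<n) r≤a/n ⟩
    a * n ⁻¹ * n    ≈⟨ solve 3 (λ a i n → a :* i :* n := i :* (n :* a)) refl a (n ⁻¹) n ⟩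
    n ⁻¹ * (n * a)  ≈⟨ x⁻¹*[x*y]≈y a 0<n ⟩
    a               ≤⟨ a≤e ⟩
    e               ∎
    where
    open ≤-Reasoning
    0<n : 0# < n
    0<n = <-≤-trans 0<u u≤n

  ≤pow∞[pow∞] : ∀ {p u s} → 1# ≤ p → 0# ≤ u → [ u ] ≤∞ s → [ u ] ≤∞ pow∞ (pow∞ s (p ⁻¹)) p
  ≤pow∞[pow∞] {s = ⊤⁺}    _   _   _           = _ Add≤.≤⊤⁺
  ≤pow∞[pow∞] {s = [ _ ]} 1≤p 0≤u Add≤.[ u≤s ] =
    Add≤.[ ≤-trans u≤s (x≤pow[pow] (≤-trans 0≤u u≤s) 1≤p) ]

  0≤pow∞ : ∀ s p → [ 0# ] ≤∞ pow∞ s p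
  0≤pow∞ ⊤⁺    _ = _ Add≤.≤⊤⁺
  0≤pow∞ [ x ] p = Add≤.[ 0≤pow x p ]

  pow∞<⊤ : ∀ {s u} q → s ≤∞ [ u ] → pow∞ s q <∞ ⊤⁺
  pow∞<⊤ q Add≤.[ _ ] = Add<.[ _ ]<⊤⁺

  ·-mono-≤∞ : ∀ {r s u} → 0# ≤ r → s ≤∞ u → r · s ≤∞ r · u
  ·-mono-≤∞ 0≤r Add≤.[ s≤u ]   = Add≤.[ *-monoˡ-≤ 0≤r s≤u ]
  ·-mono-≤∞ 0≤r (s Add≤.≤⊤⁺) = _ Add≤.≤⊤⁺

  0≤inf : {I : Set} {P : Pred I 0ℓ} {g : I → ℝ∞} → (∀ i → P i → [ 0# ] ≤∞ g i) → [ 0# ] ≤∞ inf P g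
  0≤inf nonneg = ∈⇒≤sup (≤-refl , nonneg)

  -- Nonnegativity makes 0 an admissible lower bound. Without any admissible bound the defining
  -- supremum would be that of the empty set, which `sup` sends to ∞.
  inf≤ : {I : Set} {P : Pred I 0ℓ} {g : I → ℝ} → (∀ i → P i → 0# ≤ g i) →
         ∀ i → P i → inf P ([_] ∘ g) ≤∞ [ g i ]
  inf≤ nonneg i i∈P = sup≤ (0# , ≤-refl , λ j j∈P → Add≤.[ nonneg j j∈P ])
    λ _ (_ , lower) → Add≤.[≤]-injective _≤_ (lower i i∈P)

  -- Finite sums and their suprema

  module _ {A : Set} where

    listSum : (A → ℝ) → List A → ℝ
    listSum g xs = foldr _+_ 0# (map g xs)

    listSum-++ : ∀ g xs ys → listSum g (xs ++ ys) ≈ listSum g xs + listSum g ys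
    listSum-++ g []       ys = sym (+-identityˡ _)
    listSum-++ g (x ∷ xs) ys = trans (+-congˡ (listSum-++ g xs ys)) (sym (+-assoc _ _ _))

    listSum-+ : ∀ g k xs → listSum (λ x → g x + k x) xs ≈ listSum g xs + listSum k xs
    listSum-+ g k []       = sym (+-identityˡ 0#)
    listSum-+ g k (x ∷ xs) = trans (+-congˡ (listSum-+ g k xs))
      (solve 4 (λ a b c d → (a :+ b) :+ (c :+ d) := (a :+ c) :+ (b :+ d)) refl (g x) (k x) _ _)

    listSum-*ʳ : ∀ g c xs → listSum (λ x → g x * c) xs ≈ listSum g xs * c
    listSum-*ʳ g c []       = sym (zeroˡ c)
    listSum-*ʳ g c (x ∷ xs) = trans (+-congˡ (listSum-*ʳ g c xs)) (sym (distribʳ c _ _))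

    listSum-mono-≤ : ∀ {g k} → (∀ x → g x ≤ k x) → ∀ xs → listSum g xs ≤ listSum k xs
    listSum-mono-≤ g≤k []       = ≤-refl
    listSum-mono-≤ g≤k (x ∷ xs) = +-mono-≤ (g≤k x) (listSum-mono-≤ g≤k xs)

    module _ {P : Pred A 0ℓ} (P? : Decidable P) where

      listSum-indicator : ∀ g xs →
        listSum (λ x → if does (P? x) then g x else 0#) xs ≈ listSum g (filter P? xs)
      listSum-indicator g [] = refl
      listSum-indicator g (x ∷ xs) with does (P? x)
      ... | true  = +-congˡ (listSum-indicator g xs)
      ... | false = trans (+-identityˡ _) (listSum-indicator g xs)

      listSum-split : ∀ g xs →
        listSum g xs ≈ listSum g (filter P? xs) + listSum g (filter (¬? ∘ P?) xs)
      listSum-split g [] = sym (+-identityˡ 0#)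
      listSum-split g (x ∷ xs) with does (P? x)
      ... | true  = trans (+-congˡ (listSum-split g xs)) (sym (+-assoc _ _ _))
      ... | false = trans (+-congˡ (listSum-split g xs))
        (solve 3 (λ a b c → a :+ (b :+ c) := b :+ (a :+ c)) refl (g x) _ _)

    module _ {P : Pred A 0ℓ} {g : A → ℝ} where

      listSum≤∑ : ∀ {u} → ∑ P g ≤∞ [ u ] → ∀ xs → Unique xs → All P xs → listSum g xs ≤ u
      listSum≤∑ ∑≤u xs uniq all = Add≤.[≤]-injective _≤_
        (≤∞-trans (∈⇒≤sup (xs , uniq , all , refl)) ∑≤u)

      ∑≤ : ∀ {u} → (∀ xs → Unique xs → All P xs → listSum g xs ≤ u) → ∑ P g ≤∞ [ u ]
      ∑≤ bound = sup≤ (0# , [] , [] , [] , refl)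
        λ s (xs , uniq , all , s≈) → ≤-trans (≤-reflexive s≈) (bound xs uniq all)

      0≤∑ : [ 0# ] ≤∞ ∑ P g
      0≤∑ = ∈⇒≤sup ([] , [] , [] , refl)

      scaled-∑≤ : ∀ {s c t u} → [ s ] ≤∞ ∑ P g → 0# ≤ c →
        (∀ xs → Unique xs → All P xs → c * listSum g xs + t ≤ u) → c * s + t ≤ u
      scaled-∑≤ {s} {c} {t} {u} s≤∑ 0≤c bound with lem {c ≈ 0#}
      ... | yes c≈0 = begin
        c * s + t   ≈⟨ +-congʳ (trans (*-congʳ c≈0) (trans (zeroˡ s) (sym (zeroʳ c)))) ⟩
        c * 0# + t  ≤⟨ bound [] [] [] ⟩
        u           ∎
        where open ≤-Reasoning
      ... | no c≉0 = begin
        c * s + t                   ≤⟨ +-monoˡ-≤ t (*-monoˡ-≤ 0≤c s≤) ⟩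
        c * (c ⁻¹ * (u - t)) + t    ≈⟨ +-congʳ cc⁻¹ ⟩
        (u - t) + t                 ≈⟨ x-y+y≈x u t ⟩
        u                           ∎
        where
        open ≤-Reasoning
        0<c : 0# < c
        0<c = 0≤c , λ 0≈c → c≉0 (sym 0≈c)
        cc⁻¹ : c * (c ⁻¹ * (u - t)) ≈ u - t
        cc⁻¹ = x*[x⁻¹*y]≈y _ 0<c
        s≤ : s ≤ c ⁻¹ * (u - t)
        s≤ = Add≤.[≤]-injective _≤_ (≤∞-trans s≤∑ (∑≤ λ xs uniq all → *-cancelˡ-≤ 0<c (+-cancelʳ-≤ t (begin
          c * listSum g xs + t        ≤⟨ bound xs uniq all ⟩
          u                           ≈⟨ x-y+y≈x u t ⟨
          (u - t) + t                 ≈⟨ +-congʳ cc⁻¹ ⟨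
          c * (c ⁻¹ * (u - t)) + t    ∎))))

    ∑-indicator≤ : ∀ {P : Pred A 0ℓ} (P? : Decidable P) {g : A → ℝ} {u} → ∑ P g ≤∞ [ u ] →
      ∀ xs → Unique xs → listSum (λ x → if does (P? x) then g x else 0#) xs ≤ u
    ∑-indicator≤ P? {g} ∑≤u xs uniq = ≤-trans (≤-reflexive (listSum-indicator P? g xs))
      (listSum≤∑ ∑≤u (filter P? xs) (Unique.filter⁺ P? uniq) (All.all-filter P? xs))

  -- Indicator functions and the energy of one edge

  indicator : Bool → ℝ
  indicator w = if w then 1# else 0#

  T⇒indicator≡1 : ∀ {w} → T w → indicator w ≡ 1#
  T⇒indicator≡1 {true} _ = ≡.refl

  ¬T⇒indicator≡0 : ∀ {w} → ¬ T w → indicator w ≡ 0#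
  ¬T⇒indicator≡0 {true}  ¬w = ⊥-elim (¬w _)
  ¬T⇒indicator≡0 {false} _  = ≡.refl

  ∣indicator∣≤1 : ∀ w → ∣ indicator w ∣ ≤ 1#
  ∣indicator∣≤1 true  = ∣x∣≤ ≤-refl (+-cancelʳ-≤ 1# (≤-trans (≤-reflexive (-‿inverseˡ 1#)) (+-nonneg 0≤1 0≤1)))
  ∣indicator∣≤1 false = ∣x∣≤ 0≤1 (+-cancelʳ-≤ 0# (≤-trans (≤-reflexive (-‿inverseˡ 0#)) (+-nonneg 0≤1 ≤-refl)))

  -- The Boolean tests are what `does (boundary? W (x , y))` and its swapped version reduce to, so
  -- the lemma applies to the boundary sum by computation. Multiplying by `ε` avoids a division for
  -- each edge.
  edge-energy≤ : ∀ {p β ε g g′} s t → 1# ≤ p → 0# ≤ β → 0# ≤ ε → β * ε ≤ g → β * ε ≤ g′ →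
    β * pow ∣ indicator s - indicator t ∣ p * ε ≤ (if s ∧ not t then g else 0#) + (if t ∧ not s then g′ else 0#)
  edge-energy≤ {p} {β} {ε} {g} {g′} s t 1≤p 0≤β 0≤ε βε≤g βε≤g′ = cases s t
    where
    open ≤-Reasoning
    diagonal : ∀ x → β * pow ∣ x - x ∣ p * ε ≤ 0# + 0#
    diagonal x = begin
      β * pow ∣ x - x ∣ p * ε  ≤⟨ *-monoʳ-≤ 0≤ε (*-monoˡ-≤ 0≤β (pow-zero ∣x-x∣≈0 1≤p)) ⟩
      β * 0# * ε               ≈⟨ solve 2 (λ β ε → β :* con 0 :* ε := con 0 :+ con 0) refl β ε ⟩
      0# + 0#                  ∎
      where
      ∣x-x∣≈0 : ∣ x - x ∣ ≈ 0#
      ∣x-x∣≈0 = antisym (∣x∣≤ (≤-reflexive (-‿inverseʳ x))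
        (≤-reflexive (trans (-‿cong (-‿inverseʳ x)) (trans (sym (+-identityˡ _)) (-‿inverseʳ 0#))))) (0≤∣x∣ _)
    unit : ∀ {x} → ∣ x ∣ ≤ 1# → β * pow ∣ x ∣ p * ε ≤ β * ε
    unit {x} ∣x∣≤1 = *-monoʳ-≤ 0≤ε (≤-trans (*-monoˡ-≤ 0≤β (x≤1⇒pow≤1 p (0≤∣x∣ x) ∣x∣≤1)) (≤-reflexive (*-identityʳ β)))
    cases : ∀ s t → β * pow ∣ indicator s - indicator t ∣ p * ε ≤
      (if s ∧ not t then g else 0#) + (if t ∧ not s then g′ else 0#)
    cases true  true  = diagonal 1#
    cases false false = diagonal 0#
    cases true  false = ≤-trans (unit (∣x∣≤ (≤-reflexive 1-0≈1)
      (≤-trans (≤-reflexive (-‿cong 1-0≈1)) (≤-trans (-x≤∣x∣ 1#) (∣indicator∣≤1 true)))))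
      (≤-trans βε≤g (≤-reflexive (sym (+-identityʳ g))))
      where
      1-0≈1 : 1# - 0# ≈ 1#
      1-0≈1 = trans (sym (+-identityʳ _)) (x-y+y≈x 1# 0#)
    cases false true  = ≤-trans (unit (∣x∣≤
      (≤-trans (≤-reflexive (+-identityˡ _)) (≤-trans (-x≤∣x∣ 1#) (∣indicator∣≤1 true)))
      (≤-reflexive (trans (-‿cong (+-identityˡ _)) (-‿involutive 1#)))))
      (≤-trans βε≤g′ (≤-reflexive (sym (+-identityˡ g′))))

  -- Measures and indicator functions on a graph

  module _ {X : Set} (G : Graph X) where
    open Graph G

    Light : Pred (X → Bool) 0ℓ
    Light W = Satisfiable (T ∘ W) × measure (T ∘ W) ≤∞ measure U ÷ [ 2# ]

    0≤m : ∀ x → 0# ≤ m x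
    0≤m x = proj₁ (m-pos x)

    meanDistance : ℝ → (X → ℝ) → ℝ∞
    meanDistance p f = inf U (λ γ → pow∞ (‖ (λ x → f x - γ) ‖ p) p)

    0≤rayleigh : ∀ p f → [ 0# ] ≤∞ energy p f ÷ meanDistance p f
    0≤rayleigh p f = 0≤÷
      (≤∞-trans Add≤.[ ≤-reflexive (sym (zeroʳ _)) ] (·-mono-≤∞ (⁻¹-nonneg 0≤2) 0≤∑))
      (0≤inf λ γ _ → 0≤pow∞ (‖ (λ x → f x - γ) ‖ p) p)

    measure-mono : ∀ {P τ} → measure U ≤∞ [ τ ] → measure P ≤∞ [ τ ]
    measure-mono m[X]≤τ = ∑≤ λ xs uniq _ → listSum≤∑ m[X]≤τ xs uniq (All.universal-U xs)

    measure-split : ∀ {P μ ν} → Decidable P → measure P ≤∞ [ μ ] → measure (∁ P) ≤∞ [ ν ] →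
                    measure U ≤∞ [ μ + ν ]
    measure-split P? m[P]≤μ m[∁P]≤ν = ∑≤ λ xs uniq _ → ≤-trans (≤-reflexive (listSum-split P? m xs))
      (+-mono-≤ (listSum≤∑ m[P]≤μ (filter P? xs) (Unique.filter⁺ P? uniq) (All.all-filter P? xs))
                (listSum≤∑ m[∁P]≤ν (filter (¬? ∘ P?) xs) (Unique.filter⁺ (¬? ∘ P?) uniq) (All.all-filter (¬? ∘ P?) xs)))

    measure-pos : ∀ {P μ} → Satisfiable P → measure P ≤∞ [ μ ] → 0# < μ
    measure-pos (x , x∈P) m[P]≤μ = <-≤-trans (m-pos x) (≤-trans (≤-reflexive (sym (+-identityʳ (m x))))
      (listSum≤∑ m[P]≤μ (x ∷ []) ([] ∷ []) (x∈P ∷ [])))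

    measure-empty : ∀ {P} → (∀ x → ¬ P x) → measure P ≤∞ [ 0# ]
    measure-empty ∄P = ∑≤ λ
      { []      _ _          → ≤-refl
      ; (x ∷ _) _ (x∈P ∷ _) → ⊥-elim (∄P x x∈P) }

    indicator∈ℓ^ : ∀ {τ} p W → measure U ≤∞ [ τ ] → (ℓ^ p) (indicator ∘ W)
    indicator∈ℓ^ p W m[X]≤τ = pow∞<⊤ (p ⁻¹) (∑≤ λ xs uniq all →
      ≤-trans (listSum-mono-≤ (λ x → ≤-trans (*-monoʳ-≤ (0≤m x) (x≤1⇒pow≤1 p (0≤∣x∣ _) (∣indicator∣≤1 (W x))))
                                              (≤-reflexive (*-identityˡ (m x)))) xs)
              (listSum≤∑ m[X]≤τ xs uniq all))

    indicator-nonConstant : ∀ {W x y} → T (W x) → ¬ T (W y) → NonConstant (indicator ∘ W)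
    indicator-nonConstant {x = x} {y} x∈W y∉W (c , const) = 0≉1 (begin
      0#  ≡⟨ ¬T⇒indicator≡0 y∉W ⟨
      _   ≈⟨ const y ⟩
      c   ≈⟨ const x ⟨
      _   ≡⟨ T⇒indicator≡1 x∈W ⟩
      1#  ∎)
      where open ≈-Reasoning setoid

    boundary? : ∀ W → Decidable (∂ (T ∘ W))
    boundary? W (x , y) = T? (W x) ×-dec ¬? (T? (W y))

    -- Upper bound for the energy

    module _ {d : X → X → ℝ} {ε : ℝ} (0<ε : 0# < ε)
             (ε≤d : ∀ x y → 0# < b x y → ε ≤ d x y) where

      bε≤bd : ∀ x y → b x y * ε ≤ b x y * d x y
      bε≤bd x y with lem {b x y ≈ 0#}
      ... | no  b≉0 = *-monoˡ-≤ (b-nonneg x y) (ε≤d x y (b-nonneg x y , λ 0≈b → b≉0 (sym 0≈b)))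
      ... | yes b≈0 = ≤-reflexive (trans (*-congʳ b≈0) (trans (zeroˡ _) (sym (trans (*-congʳ b≈0) (zeroˡ _)))))

      -- Each of the two orientations of a boundary edge contributes to the
      -- energy, so the factor 1/2 cancels.
      energy-indicator≤ : ∀ {p t} W → 1# ≤ p → boundaryMeasure d (T ∘ W) ≤∞ [ t ] →
                          energy p (indicator ∘ W) ≤∞ [ ε ⁻¹ * t ]
      energy-indicator≤ {p} {t} W 1≤p ∂W≤t = ≤∞-trans
        (·-mono-≤∞ (⁻¹-nonneg 0≤2) (∑≤ λ zs uniq _ → *-cancelˡ-≤ 0<ε (bound zs uniq)))
        Add≤.[ ≤-reflexive 2⁻¹ε⁻¹[t+t]≈ε⁻¹t ]
        where
        open ≤-Reasoning
        ∂? : Decidable (∂ (T ∘ W))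
        ∂? = boundary? W
        e g k k′ : X × X → ℝ
        e = uncurry λ x y → b x y * pow ∣ indicator (W x) - indicator (W y) ∣ p
        g = uncurry λ x y → b x y * d x y
        k z = if does (∂? z) then g z else 0#
        k′ = k ∘ swap
        eε≤k+k′ : ∀ z → e z * ε ≤ k z + k′ z
        eε≤k+k′ (x , y) = edge-energy≤ (W x) (W y) 1≤p (b-nonneg x y) (proj₁ 0<ε) (bε≤bd x y)
          (≤-trans (≤-reflexive (*-congʳ (b-sym x y))) (bε≤bd y x))
        bound : ∀ zs → Unique zs → ε * listSum e zs ≤ ε * (ε ⁻¹ * (t + t))
        bound zs uniq = begin
          ε * listSum e zs                 ≈⟨ *-comm ε _ ⟩
          listSum e zs * ε                 ≈⟨ listSum-*ʳ e ε zs ⟨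
          listSum (λ z → e z * ε) zs       ≤⟨ listSum-mono-≤ eε≤k+k′ zs ⟩
          listSum (λ z → k z + k′ z) zs    ≈⟨ listSum-+ k k′ zs ⟩
          -- The reversed orientations are moved into the list. Since `swap` is injective, the new
          -- list is again duplicate-free, and the same boundary sum bounds both parts.
          listSum k zs + listSum k′ zs     ≡⟨ ≡.cong (λ ks → listSum k zs + foldr _+_ 0# ks) (Listₚ.map-∘ zs) ⟩
          listSum k zs + listSum k (map swap zs)
            ≤⟨ +-mono-≤ (∑-indicator≤ ∂? ∂W≤t zs uniq)
                        (∑-indicator≤ ∂? ∂W≤t (map swap zs) (Unique.map⁺ (λ { {_ , _} {_ , _} ≡.refl → ≡.refl }) uniq)) ⟩
          t + t                            ≈⟨ x*[x⁻¹*y]≈y (t + t) 0<ε ⟨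
          ε * (ε ⁻¹ * (t + t))             ∎
        2⁻¹ε⁻¹[t+t]≈ε⁻¹t : 2# ⁻¹ * (ε ⁻¹ * (t + t)) ≈ ε ⁻¹ * t
        2⁻¹ε⁻¹[t+t]≈ε⁻¹t = trans (*-congˡ (solve 2 (λ i t → i :* (t :+ t) := con 2 :* (i :* t)) refl (ε ⁻¹) t))
          (x⁻¹*[x*y]≈y _ 0<2)

    -- Lower bound for the distance to the constants

    module _ {p μ ν : ℝ} (1≤p : 1# ≤ p) (W : X → Bool) (0≤μ : 0# ≤ μ) (μ≤ν : μ ≤ ν)
             (μ≤m[W] : [ μ ] ≤∞ measure (T ∘ W)) (ν≤m[∁W] : [ ν ] ≤∞ measure (∁ (T ∘ W))) where

      private
        C : ℝ
        C = pow 2# (p - 1#)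

        0<C : 0# < C
        0<C = 0<2^[p-1] 1≤p

      -- The factor 2^(1-p) is written as `C ⁻¹` because `pow` is meant for nonnegative exponents.
      -- The convexity inequality is applied to |1-γ| and |0-γ|, whose sum is at least 1.
      meanDistance-indicator≥ : [ μ * C ⁻¹ ] ≤∞ meanDistance p (indicator ∘ W)
      meanDistance-indicator≥ = ∈⇒≤sup (0≤μ/C , λ γ _ → ≤pow∞[pow∞] 1≤p 0≤μ/C (≤∞-from-bounds _ (bound γ)))
        where
        open ≤-Reasoning
        0≤μ/C : 0# ≤ μ * C ⁻¹
        0≤μ/C = *-nonneg 0≤μ (⁻¹-nonneg (proj₁ 0<C))
        bound : ∀ γ s → ∑ U (λ x → pow ∣ indicator (W x) - γ ∣ p * m x) ≤∞ [ s ] → μ * C ⁻¹ ≤ s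
        bound γ s ∑≤s = begin
          μ * C ⁻¹                      ≈⟨ *-identityʳ _ ⟨
          μ * C ⁻¹ * 1#                 ≤⟨ *-monoˡ-≤ 0≤μ/C (1≤2^[p-1][u^p+v^p] 1≤p (0≤∣x∣ _) (0≤∣x∣ _) 1≤u+v) ⟩
          μ * C ⁻¹ * (C * (A + B))
            ≈⟨ solve 4 (λ μ i C S → μ :* i :* (C :* S) := i :* (C :* (S :* μ))) refl μ (C ⁻¹) C (A + B) ⟩
          C ⁻¹ * (C * ((A + B) * μ))    ≈⟨ x⁻¹*[x*y]≈y _ 0<C ⟩
          (A + B) * μ                   ≈⟨ distribʳ μ A B ⟩
          A * μ + B * μ                 ≤⟨ +-monoʳ-≤ _ (*-monoˡ-≤ 0≤B μ≤ν) ⟩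
          A * μ + B * ν                 ≤⟨ scaled-∑≤ μ≤m[W] 0≤A outer ⟩
          s                             ∎
          where
          A B : ℝ
          A = pow ∣ 1# - γ ∣ p
          B = pow ∣ 0# - γ ∣ p
          0≤A : 0# ≤ A
          0≤A = 0≤pow _ p
          0≤B : 0# ≤ B
          0≤B = 0≤pow _ p
          1≤u+v : 1# ≤ ∣ 1# - γ ∣ + ∣ 0# - γ ∣
          1≤u+v = begin
            1#                          ≈⟨ x-y+y≈x 1# γ ⟨
            (1# - γ) + γ                ≈⟨ +-congˡ (-‿involutive γ) ⟨
            (1# - γ) + - (- γ)          ≈⟨ +-congˡ (-‿cong (+-identityˡ (- γ))) ⟨
            (1# - γ) + - (0# - γ)       ≤⟨ +-mono-≤ (x≤∣x∣ _) (-x≤∣x∣ _) ⟩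
            ∣ 1# - γ ∣ + ∣ 0# - γ ∣     ∎
          φ : X → ℝ
          φ x = pow ∣ indicator (W x) - γ ∣ p * m x
          φ-on : ∀ {v xs} → All (λ x → indicator (W x) ≡ v) xs → listSum φ xs ≈ pow ∣ v - γ ∣ p * listSum m xs
          φ-on [] = sym (zeroʳ _)
          φ-on {v} (_∷_ {x} x∈ xs∈) = trans
            (+-cong (reflexive (≡.cong (λ w → pow ∣ w - γ ∣ p * m x) x∈)) (φ-on xs∈)) (sym (distribˡ _ _ _))
          -- Finite parts of `W` and of its complement are disjoint, so their concatenation is
          -- duplicate-free and gives a single partial sum of the p-th powers.
          inner : ∀ xs ys → Unique xs → All (T ∘ W) xs → Unique ys → All (∁ (T ∘ W)) ys →
                  B * listSum m ys + A * listSum m xs ≤ s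
          inner xs ys xs! xs∈ ys! ys∉ = begin
            B * listSum m ys + A * listSum m xs
              ≈⟨ +-cong (φ-on (All.map ¬T⇒indicator≡0 ys∉)) (φ-on (All.map T⇒indicator≡1 xs∈)) ⟨
            listSum φ ys + listSum φ xs           ≈⟨ listSum-++ φ ys xs ⟨
            listSum φ (ys ++ xs)
              ≤⟨ listSum≤∑ ∑≤s (ys ++ xs)
                   (Unique.++⁺ ys! xs! λ (y∈ys , y∈xs) → All.lookup ys∉ y∈ys (All.lookup xs∈ y∈xs))
                   (All.universal-U _) ⟩
            s                                     ∎
          outer : ∀ xs → Unique xs → All (T ∘ W) xs → A * listSum m xs + B * ν ≤ s
          outer xs xs! xs∈ = ≤-trans (≤-reflexive (+-comm _ _))
            (scaled-∑≤ ν≤m[∁W] 0≤B λ ys ys! ys∉ → inner xs ys xs! xs∈ ys! ys∉)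

    -- Comparison of the two infima

    -- Together with `0# ≤ r` this is membership in the set whose supremum is `λ¹ p`.
    IsRayleighBound : ℝ → ℝ → Set
    IsRayleighBound p r = ∀ f → (ℓ^ p) f × NonConstant f → [ r ] ≤∞ energy p f ÷ meanDistance p f

    -- Turns a lower bound of the Rayleigh quotients into one of the isoperimetric quotients, hence
    -- into a member of the set whose supremum is `h¹ d`.
    light-bound : ∀ {τ p r ε d} → measure U ≡ [ τ ] → 1# ≤ p → 0# ≤ r → IsRayleighBound p r →
      0# < ε → (∀ x y → 0# < b x y → ε ≤ d x y) →
      ∀ W → Light W → [ pow 2# (p - 1#) ⁻¹ * (r * ε) ] ≤∞ boundaryMeasure d (T ∘ W) ÷ measure (T ∘ W)
    light-bound {τ} {p} {r} {ε} {d} m[X]≡τ 1≤p 0≤r rayleigh 0<ε ε≤d W ((x₀ , x₀∈W) , m[W]≤) =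
      -- `÷` reduces only on explicit values, so the finite measure of `W` is named and substituted
      -- into the quotient.
      let m[X]≤τ = ≤∞-reflexive m[X]≡τ
          μ , m[W]≡μ , μ≤τ/2 = ≤∞⇒finite (≡.subst (λ t → measure (T ∘ W) ≤∞ t ÷ [ 2# ]) m[X]≡τ m[W]≤)
          ν , m[∁W]≡ν , _ = ≤∞⇒finite (measure-mono m[X]≤τ)
      in ≡.subst (λ t → [ pow 2# (p - 1#) ⁻¹ * (r * ε) ] ≤∞ boundaryMeasure d (T ∘ W) ÷ t) (≡.sym m[W]≡μ)
           (finite-case m[X]≤τ μ≤τ/2 m[W]≡μ m[∁W]≡ν)
      where
      open ≤-Reasoning
      finite-case : ∀ {μ ν} → measure U ≤∞ [ τ ] → μ ≤ τ * 2# ⁻¹ →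
        measure (T ∘ W) ≡ [ μ ] → measure (∁ (T ∘ W)) ≡ [ ν ] →
        [ pow 2# (p - 1#) ⁻¹ * (r * ε) ] ≤∞ boundaryMeasure d (T ∘ W) ÷ [ μ ]
      finite-case {μ} {ν} m[X]≤τ μ≤τ/2 m[W]≡μ m[∁W]≡ν = ≤÷ (boundaryMeasure d (T ∘ W)) 0<μ bound
        where
        C : ℝ
        C = pow 2# (p - 1#)
        0<C : 0# < C
        0<C = 0<2^[p-1] 1≤p
        0<C⁻¹ : 0# < C ⁻¹
        0<C⁻¹ = *-cancelˡ-< (proj₁ 0<C) (begin-strict
          C * 0#     ≈⟨ zeroʳ C ⟩
          0#         <⟨ 0<1 ⟩
          1#         ≈⟨ *-inverseʳ (pos⇒≉0 0<C) ⟨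
          C * C ⁻¹   ∎)
        0<μ : 0# < μ
        0<μ = measure-pos (x₀ , x₀∈W) (≤∞-reflexive m[W]≡μ)
        τ≤μ+ν : τ ≤ μ + ν
        τ≤μ+ν = Add≤.[≤]-injective _≤_ (≡.subst (λ t → t ≤∞ [ μ + ν ]) m[X]≡τ
          (measure-split (λ x → T? (W x)) (≤∞-reflexive m[W]≡μ) (≤∞-reflexive m[∁W]≡ν)))
        μ≤ν : μ ≤ ν
        μ≤ν = +-cancelʳ-≤ μ (begin
          μ + μ            ≈⟨ solve 1 (λ μ → μ :+ μ := con 2 :* μ) refl μ ⟩
          2# * μ           ≤⟨ *-monoˡ-≤ 0≤2 μ≤τ/2 ⟩
          2# * (τ * 2# ⁻¹) ≈⟨ solve 3 (λ t τ i → t :* (τ :* i) := i :* (t :* τ)) refl 2# τ (2# ⁻¹) ⟩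
          2# ⁻¹ * (2# * τ) ≈⟨ x⁻¹*[x*y]≈y τ 0<2 ⟩
          τ                ≤⟨ τ≤μ+ν ⟩
          μ + ν            ≈⟨ +-comm μ ν ⟩
          ν + μ            ∎)
        nonConstant : NonConstant (indicator ∘ W)
        -- A point outside `W` is obtained only indirectly: a constant indicator would leave the
        -- complement empty, hence of measure at most 0, while ν ≥ μ > 0.
        nonConstant const = <⇒≱ (<-≤-trans 0<μ μ≤ν) (Add≤.[≤]-injective _≤_
          (≡.subst (λ t → t ≤∞ [ 0# ]) m[∁W]≡ν
            (measure-empty λ y y∉W → indicator-nonConstant x₀∈W y∉W const)))
        bound : ∀ t → boundaryMeasure d (T ∘ W) ≤∞ [ t ] → C ⁻¹ * (r * ε) * μ ≤ t
        bound t ∂W≤t = begin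
          C ⁻¹ * (r * ε) * μ
            ≈⟨ solve 4 (λ i r ε μ → i :* (r :* ε) :* μ := ε :* (r :* (μ :* i))) refl (C ⁻¹) r ε μ ⟩
          ε * (r * (μ * C ⁻¹))    ≤⟨ *-monoˡ-≤ (proj₁ 0<ε) (÷-bound 0≤r 0≤ε⁻¹t (*-pos 0<μ 0<C⁻¹)
                                       (energy-indicator≤ 0<ε ε≤d W 1≤p ∂W≤t)
                                       (meanDistance-indicator≥ 1≤p W (proj₁ 0<μ) μ≤ν
                                         (≤∞-reflexive (≡.sym m[W]≡μ)) (≤∞-reflexive (≡.sym m[∁W]≡ν)))
                                       (rayleigh (indicator ∘ W) (indicator∈ℓ^ p W m[X]≤τ , nonConstant))) ⟩
          ε * (ε ⁻¹ * t)          ≈⟨ x*[x⁻¹*y]≈y t 0<ε ⟩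
          t                       ∎
          where
          0≤ε⁻¹t : 0# ≤ ε ⁻¹ * t
          0≤ε⁻¹t = *-nonneg (⁻¹-nonneg (proj₁ 0<ε)) (Add≤.[≤]-injective _≤_ (≤∞-trans 0≤∑ ∂W≤t))

    module _ {τ p : ℝ} {d : X → X → ℝ} (m[X]≡τ : measure U ≡ [ τ ]) (1≤p : 1# ≤ p) where

      private
        C : ℝ
        C = pow 2# (p - 1#)

        0<C : 0# < C
        0<C = 0<2^[p-1] 1≤p

      -- Stated for any positive lower bound `ε` of d on the edges, since an infinite `δ` is not
      -- itself a real number to insert.
      h¹-bound : ∀ {r ε h} → 0# ≤ r → IsRayleighBound p r → 0# < ε →
        (∀ x y → 0# < b x y → ε ≤ d x y) → h¹ d ≤∞ [ h ] → r * ε ≤ C * h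
      h¹-bound {r} {ε} {h} 0≤r rayleigh 0<ε ε≤d h¹≤h = begin
        r * ε                  ≈⟨ x*[x⁻¹*y]≈y _ 0<C ⟨
        C * (C ⁻¹ * (r * ε))   ≤⟨ *-monoˡ-≤ (proj₁ 0<C) (Add≤.[≤]-injective _≤_ (≤∞-trans
                                    (∈⇒≤sup ( *-nonneg (⁻¹-nonneg (proj₁ 0<C)) (*-nonneg 0≤r (proj₁ 0<ε))
                                            , light-bound m[X]≡τ 1≤p 0≤r rayleigh 0<ε ε≤d))
                                    h¹≤h)) ⟩
        C * h                  ∎
        where open ≤-Reasoning

      -- `h` and `δ` are variables so that finite and infinite values can be separated by matching,
      -- which the suprema `h¹ d` and `δ d` do not allow directly.
      λ¹≤ : ∀ {h δ} → h¹ d ≤∞ h → [ 0# ] <∞ δ → (∀ x y → 0# < b x y → δ ≤∞ [ d x y ]) →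
            λ¹ p ≤∞ C · (h ÷ δ)
      λ¹≤ {⊤⁺} _ _ _ = _ Add≤.≤⊤⁺
      λ¹≤ {[ h ]} {[ δ ]} h¹≤h Add<.[ 0<δ ] δ≤d = sup≤ (0# , ≤-refl , λ f _ → 0≤rayleigh p f)
        λ r (0≤r , rayleigh) → *-cancelˡ-≤ 0<δ (begin
          δ * r                  ≈⟨ *-comm δ r ⟩
          r * δ                  ≤⟨ h¹-bound 0≤r rayleigh 0<δ (λ x y 0<b → Add≤.[≤]-injective _≤_ (δ≤d x y 0<b)) h¹≤h ⟩
          C * h                  ≈⟨ x⁻¹*[x*y]≈y _ 0<δ ⟨
          δ ⁻¹ * (δ * (C * h))
            ≈⟨ solve 4 (λ i δ C h → i :* (δ :* (C :* h)) := δ :* (C :* (h :* i))) refl (δ ⁻¹) δ C h ⟩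
          δ * (C * (h * δ ⁻¹))   ∎)
        where open ≤-Reasoning
      -- There are no edges, so every ε > 0 bounds d from below on the edges.
      λ¹≤ {[ h ]} {⊤⁺} h¹≤h _ δ≤d = sup≤ (0# , ≤-refl , λ f _ → 0≤rayleigh p f)
        λ r (0≤r , rayleigh) → ≤-trans (≮⇒≥ λ 0<r → ∀-fromℕ≤⇒⊥ (r ⁻¹ * (C * h)) λ n → *-cancelˡ-≤ 0<r (begin
          r * fromℕ n              ≤⟨ *-monoˡ-≤ 0≤r (≤-trans (x≤x+y 0≤1) (≤-reflexive (+-comm _ 1#))) ⟩
          r * fromℕ (suc n)        ≤⟨ h¹-bound 0≤r rayleigh (0<fromℕ[1+n] n) (λ x y 0<b → no-edge (δ≤d x y 0<b)) h¹≤h ⟩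
          C * h                    ≈⟨ x*[x⁻¹*y]≈y _ 0<r ⟨
          r * (r ⁻¹ * (C * h))     ∎)) (≤-reflexive (sym (zeroʳ C)))
        where
        open ≤-Reasoning
        no-edge : ∀ {x} {A : Set} → ⊤⁺ ≤∞ [ x ] → A
        no-edge ()

theorem3p10 : (lem : ExcludedMiddle 0ℓ) (R : CompleteOrderedField) →
    let open Classical lem R in
    (X : Set) → X ↣ ℕ → ∃₂ (λ (x y : X) → x ≢ y) →
    (G : Graph X) → let open Graph G in
    measure U <∞ ⊤⁺ →
    (p : ℝ) → 1# ≤ p →
    (d : X → X → ℝ) → (∀ x y → 0# ≤ d x y) →
    [ 0# ] <∞ δ d →
    λ¹ p ≤∞ pow 2# (p - 1#) · (h¹ d ÷ δ d)
theorem3p10 lem R X _ _ G m[X]<⊤ p 1≤p d 0≤d 0<δ =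
  λ¹≤ G (proj₂ (<⊤⇒finite m[X]<⊤)) 1≤p (≤∞-reflexive ≡.refl) 0<δ
    λ x y 0<b → inf≤ (λ (x , y) _ → 0≤d x y) (x , y) 0<b
  where open Theory lem R
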